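{- Let $Y$ be the affine curve (of genus 5) over $\mathbb{Q}$ in coordinates $(x,y,z)$ defined by \[ y^2 = (5x^2-1)(x^2+3), \qquad z^2 = -(3x^2+1)(x^2-5). \] Then $Y(\mathbb{Q},2) = Y(\mathbb{Q}) = \{(\pm1,\pm4,\pm4)\}$.
   Context: For a curve $X$ defined over $\mathbb{Q}$, $X(\mathbb{Q},2)$ denotes the set of points $P \in X(\overline{\mathbb{Q}})$ with $[\mathbb{Q}(P):\mathbb{Q}] \le 2$. Sign choices are independent. -}

module Defs where

open import Data.Nat using (ℕ)
open import Data.Integer using (+_)
open import Data.Rational using (ℚ; 0ℚ; 1ℚ; _+_; _*_; -_; _-_; _/_)
open import Data.Product using (_×_)
open import Data.Sum using (_⊎_)
open import Data.Empty using (⊥)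
open import Relation.Binary.PropositionalEquality using (_≡_)

-- The quadratic algebra ℚ(√d) = ℚ[t]/(t² - d), elements a + b√d.
-- For d not a square in ℚ this is a field, the quadratic field ℚ(√d).
record Q√ (d : ℚ) : Set where
  constructor _+_√
  field
    re : ℚ
    im : ℚ
open Q√ public

module _ {d : ℚ} where
  infixl 6 _⊕_ _⊖_
  infixl 7 _⊗_

  _⊕_ : Q√ d → Q√ d → Q√ d
  (a + b √) ⊕ (c + e √) = (a + c) + (b + e) √

  ⊝_ : Q√ d → Q√ d
  ⊝ (a + b √) = (- a) + (- b) √

  _⊖_ : Q√ d → Q√ d → Q√ d
  u ⊖ v = u ⊕ (⊝ v)

  _⊗_ : Q√ d → Q√ d → Q√ d
  (a + b √) ⊗ (c + e √) = (a * c + d * (b * e)) + (a * e + b * c) √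

  ι : ℚ → Q√ d
  ι q = q + 0ℚ √

[_]ℚ : ℕ → ℚ
[ n ]ℚ = + n / 1

NonSquare : ℚ → Set
NonSquare d = (q : ℚ) → q * q ≡ d → ⊥

OnY : (d : ℚ) → Q√ d → Q√ d → Q√ d → Set
OnY d x y z =
  (y ⊗ y ≡ (ι [ 5 ]ℚ ⊗ x ⊗ x ⊖ ι 1ℚ) ⊗ (x ⊗ x ⊕ ι [ 3 ]ℚ))
  × (z ⊗ z ≡ ⊝ ((ι [ 3 ]ℚ ⊗ x ⊗ x ⊕ ι 1ℚ) ⊗ (x ⊗ x ⊖ ι [ 5 ]ℚ)))

IsPM : ℚ → ℕ → Set
IsPM q n = (q ≡ [ n ]ℚ) ⊎ (q ≡ - [ n ]ℚ)

IsListedPoint : (d : ℚ) → Q√ d → Q√ d → Q√ d → Set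
IsListedPoint d x y z =
  (im x ≡ 0ℚ) × (im y ≡ 0ℚ) × (im z ≡ 0ℚ)
  × IsPM (re x) 1 × IsPM (re y) 4 × IsPM (re z) 4

{-# OPTIONS --safe #-}
module Submission where

-- Write F_A(X) = A X² + 14 X + B with B = 2 - A and A B = -15, so that {A, B} = {5, -3}. The curve is
-- y² = F_5(x²), z² = F_{-3}(x²). Everything rests on the infinite descent which shows that
-- a² + d² = c², a² + q² d² = b² has no rational solution with a d ≠ 0 for q = 2 and q = 4. With q = 4 it
-- gives x = ±1 as the only rational abscissae of y² = F_A(x²), with q = 2 it gives w = 0 or X² = 1 as the
-- only rational points of w² = F_A(X) F_B(X).
-- Let (x, y) be a point of y² = F_A(x²) with x quadratic over ℚ, x² = T x - N. The parabola through this
-- point, its conjugate and (1, 4) meets the curve in a fourth, rational point, which must be one of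
-- (±1, ±4). This forces either T = 0 and y rational, or T² = A N² + 2 N + B. Comparing this for A = 5 and
-- A = -3 leaves T = 0, that is x² ∈ ℚ, which signs or the second descent exclude. For rational x, either y or
-- z is rational and the first descent gives x² = 1, or y z is rational and the second one does.

open import Defs
open import Data.Empty using (⊥; ⊥-elim)
open import Data.Fin using (toℕ; fromℕ<)
import Data.Fin.Properties as Fin
open import Data.Nat as ℕ using (ℕ; zero; suc)
import Data.Nat.Properties as ℕ
import Data.Nat.Tactic.RingSolver as ℕ-Solver
open import Data.Nat.Coprimality as Coprimality using (Coprime; coprime-divisor; coprime-factors; coprime-/gcd)
open import Data.Product using (∃; _×_; _,_; proj₁; proj₂)
open import Data.Sum as Sum using (_⊎_; inj₁; inj₂; [_,_]′; reduce)
open import Function using (_∘_; id; case_of_)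
open import Function.Bundles using (_⇔_; mk⇔)
open import Level using (0ℓ)
open import Relation.Nullary using (¬_; Dec; yes; no)
open import Relation.Nullary.Decidable using (from-yes; from-no; dec⇒maybe; _→-dec_; _⊎-dec_)
open import Relation.Binary.PropositionalEquality

-- Parity, squares modulo 3 and 8, and coprimality in ℕ.

module Natural where
  open import Data.Nat hiding (parity)
  open import Data.Nat.Divisibility
  open import Data.Nat.GCD using (gcd; gcd[m,n]∣m; gcd[m,n]∣n; gcd[m,n]≢0)
  open import Data.Nat.Induction using (<-rec)
  open import Data.Nat.Properties
  open ℕ-Solver using (solve-∀)

  Odd : ℕ → Set
  Odd n = ¬ 2 ∣ n

  data Parity : ℕ → Set where
    even : ∀ k → Parity (2 * k)
    odd  : ∀ k → Parity (1 + 2 * k)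

  parity : ∀ n → Parity n
  parity zero = even 0
  parity (suc n) with parity n
  ... | even k = odd k
  ... | odd k  = subst Parity (lem k) (even (suc k))
    where
    lem : ∀ k → 2 * suc k ≡ 2 + 2 * k
    lem = solve-∀

  ∣m+n∣n⇒∣m : ∀ {d m n} → d ∣ m + n → d ∣ n → d ∣ m
  ∣m+n∣n⇒∣m {d} {m} {n} p = ∣m+n∣m⇒∣n (subst (d ∣_) (+-comm m n) p)

  even≢odd′ : ∀ m n → 2 * m ≢ 1 + 2 * n
  even≢odd′ m n eq with ∣m+n∣n⇒∣m {2} {1} {2 * n} (subst (2 ∣_) eq (m∣m*n m)) (m∣m*n n)
  ... | 2∣1 with ∣1⇒≡1 2∣1
  ... | ()

  odd-divisor : ∀ {m n} → m ∣ n → Odd n → Odd m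
  odd-divisor m∣n on 2∣m = on (∣-trans 2∣m m∣n)

  odd≢0 : ∀ {n} → Odd n → n ≢ 0
  odd≢0 on refl = on (divides 0 refl)

  odd⇒coprime-2 : ∀ {n} → Odd n → Coprime n 2
  odd⇒coprime-2 on {zero} (_ , 0∣2) = case 0∣⇒≡0 0∣2 of λ ()
  odd⇒coprime-2 on {suc zero} _ = refl
  odd⇒coprime-2 on {suc (suc zero)} (2∣n , _) = ⊥-elim (on 2∣n)
  odd⇒coprime-2 on {suc (suc (suc k))} (_ , d) with ∣⇒≤ d
  ... | s≤s (s≤s ())

  odd-square : ∀ k → ∃ λ u → (1 + 2 * k) * (1 + 2 * k) ≡ 1 + 8 * u
  odd-square zero = 0 , refl
  odd-square (suc k) with odd-square k
  ... | u , eq = u + suc k , (begin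
    (1 + 2 * suc k) * (1 + 2 * suc k)          ≡⟨ lem₁ k ⟩
    (1 + 2 * k) * (1 + 2 * k) + 8 * suc k      ≡⟨ cong (_+ 8 * suc k) eq ⟩
    1 + 8 * u + 8 * suc k                      ≡⟨ lem₂ u k ⟩
    1 + 8 * (u + suc k)                        ∎)
    where
    open ≡-Reasoning
    lem₁ : ∀ k → (1 + 2 * suc k) * (1 + 2 * suc k) ≡ (1 + 2 * k) * (1 + 2 * k) + 8 * suc k
    lem₁ = solve-∀
    lem₂ : ∀ u k → 1 + 8 * u + 8 * suc k ≡ 1 + 8 * (u + suc k)
    lem₂ = solve-∀

  square-mod-3 : ∀ n → 3 ∣ n ⊎ ∃ λ u → n * n ≡ 1 + 3 * u
  square-mod-3 zero = inj₁ (divides 0 refl)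
  square-mod-3 (suc zero) = inj₂ (0 , refl)
  square-mod-3 (suc (suc zero)) = inj₂ (1 , refl)
  square-mod-3 (suc (suc (suc n))) with square-mod-3 n
  ... | inj₁ 3∣n = inj₁ (∣m∣n⇒∣m+n {3} {3} ∣-refl 3∣n)
  ... | inj₂ (u , eq) = inj₂ (u + 3 + 2 * n , trans (lem₁ n) (trans (cong (_+ (9 + 6 * n)) eq) (lem₂ u n)))
    where
    lem₁ : ∀ n → (3 + n) * (3 + n) ≡ n * n + (9 + 6 * n)
    lem₁ = solve-∀
    lem₂ : ∀ u n → 1 + 3 * u + (9 + 6 * n) ≡ 1 + 3 * (u + 3 + 2 * n)
    lem₂ = solve-∀

  -- Squares are 0 or 1 modulo 3, so a sum of two is a multiple of 3 only if both terms are.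
  3∤coprime-squares : ∀ m n → Coprime m n → ¬ 3 ∣ m * m + n * n
  3∤coprime-squares m n c 3∣s with square-mod-3 m | square-mod-3 n
  ... | inj₁ 3∣m | inj₁ 3∣n = case c (3∣m , 3∣n) of λ ()
  ... | inj₁ 3∣m | inj₂ (v , eq) = from-no (3 ∣? 1) (∣m+n∣n⇒∣m (subst (3 ∣_) eq (∣m+n∣m⇒∣n 3∣s
      (∣m⇒∣m*n m 3∣m))) (m∣m*n v))
  ... | inj₂ (u , eq) | inj₁ 3∣n = from-no (3 ∣? 1) (∣m+n∣n⇒∣m (subst (3 ∣_) eq (∣m+n∣n⇒∣m 3∣s
      (∣m⇒∣m*n n 3∣n))) (m∣m*n u))
  ... | inj₂ (u , eq) | inj₂ (v , eq′) = from-no (3 ∣? 2) (∣m+n∣n⇒∣m (subst (3 ∣_) (trans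
      (cong₂ _+_ eq eq′) (lem u v)) 3∣s) (m∣m*n (u + v)))
    where
    lem : ∀ u v → 1 + 3 * u + (1 + 3 * v) ≡ 2 + 3 * (u + v)
    lem = solve-∀

  coprime-* : ∀ {m n o} → Coprime m n → Coprime m o → Coprime m (n * o)
  coprime-* cn co (x∣m , x∣no) =
    co (x∣m , coprime-divisor (λ (y∣x , y∣n) → cn (∣-trans y∣x x∣m , y∣n)) x∣no)

  coprime-squares : ∀ {m n} → Coprime m n → Coprime (m * m) (n * n)
  coprime-squares c = coprime-* c² c²
    where c² = Coprimality.sym (coprime-* (Coprimality.sym c) (Coprimality.sym c))

  gcd-split : ∀ m n → m ≢ 0 → ∃ λ g → ∃ λ m′ → ∃ λ n′ → m ≡ m′ * g × n ≡ n′ * g × Coprime m′ n′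
  gcd-split m n m≢0 = g , m / g , n / g
      , sym (m/n*n≡m (gcd[m,n]∣m m n)) , sym (m/n*n≡m (gcd[m,n]∣n m n)) , coprime-/gcd m n
    where
    open import Data.Nat.DivMod using (_/_; m/n*n≡m)
    g = gcd m n
    instance
      g≢0 : NonZero g
      g≢0 = ≢-nonZero (gcd[m,n]≢0 m n (inj₁ m≢0))

  *≢0ʳ : ∀ m {n} → m * n ≢ 0 → n ≢ 0
  *≢0ʳ m mn≢0 refl = mn≢0 (*-zeroʳ m)

  *-cancelʳ : ∀ {m n} o → o ≢ 0 → m * o ≡ n * o → m ≡ n
  *-cancelʳ {m} {n} o o≢0 = *-cancelʳ-≡ m n o {{≢-nonZero o≢0}}

  *-cancelˡ : ∀ {m n} o → o ≢ 0 → o * m ≡ o * n → m ≡ n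
  *-cancelˡ {m} {n} o o≢0 = *-cancelˡ-≡ m n o {{≢-nonZero o≢0}}

  -- Primitive Pythagorean triples.

  -- Euclid's formulas a = e² - f², d = 2 e f, with the subtraction moved to the other side.
  Parametrised : ℕ → ℕ → Set
  Parametrised a d = ∃ λ e → ∃ λ f → e * e ≡ a + f * f × d ≡ 2 * (e * f) × Coprime e f

  module _ {a c d : ℕ} (oa : Odd a) (cop : Coprime a d) (eq : a * a + d * d ≡ c * c) where
    private
      a≤c : a ≤ c
      a≤c = ≮⇒≥ λ c<a → <⇒≱ (*-mono-< c<a c<a) (subst (a * a ≤_) eq (m≤m+n _ _))

      w s : ℕ
      w = c ∸ a
      s = 2 * a + w

      c≡ : c ≡ a + w
      c≡ = sym (m+[n∸m]≡n a≤c)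

      d²≡ : d * d ≡ w * s
      d²≡ = +-cancelˡ-≡ (a * a) _ _ (trans eq (trans (cong₂ _*_ c≡ c≡) (lem a w)))
        where
        lem : ∀ a w → (a + w) * (a + w) ≡ a * a + w * (2 * a + w)
        lem = solve-∀

      s≢0 : s ≢ 0
      s≢0 s≡0 = odd≢0 oa (m+n≡0⇒m≡0 a (m+n≡0⇒m≡0 (2 * a) s≡0))

    private
      -- Cancelling g in d² = w s leaves f² g = w e, and e is coprime to f.
      gcd-divisible : ∀ {e f g} → s ≡ e * g → d ≡ f * g → Coprime e f → e ∣ g
      gcd-divisible {e} {f} {g} s≡eg d≡fg cop-ef =
        coprime-divisor {o = g} cop-ef (coprime-divisor {o = f * g} cop-ef
          (divides w (*-cancelʳ g g≢0 (begin
            f * (f * g) * g      ≡⟨ lem f g ⟩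
            (f * g) * (f * g)    ≡⟨ cong₂ _*_ d≡fg d≡fg ⟨
            d * d                ≡⟨ d²≡ ⟩
            w * s                ≡⟨ cong (w *_) s≡eg ⟩
            w * (e * g)          ≡⟨ *-assoc w e g ⟨
            w * e * g            ∎))))
        where
        open ≡-Reasoning
        g≢0 = *≢0ʳ e (subst (_≢ 0) s≡eg s≢0)
        lem : ∀ f g → f * (f * g) * g ≡ (f * g) * (f * g)
        lem = solve-∀

    -- With w = c - a and s = c + a, d² = w s. For g = gcd(s, d) = t e this becomes s = t e², w = t
    -- f² and d = t e f. Then t divides 2 a and d, hence 2, and t = 2 is the claim.
    pythagorean : Parametrised a d
    pythagorean with gcd-split s d s≢0
    ... | g , e , f , s≡eg , d≡fg , cop-ef with gcd-divisible s≡eg d≡fg cop-ef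
    ... | divides t refl = conclude t≤2 t∣2 s≡ te²≡ d≡fg
      where
      open ≡-Reasoning
      te≢0 : t * e ≢ 0
      te≢0 = *≢0ʳ e (subst (_≢ 0) s≡eg s≢0)
      w≡ : w ≡ t * (f * f)
      w≡ = *-cancelʳ s s≢0 (begin
        w * s                     ≡⟨ d²≡ ⟨
        d * d                     ≡⟨ cong₂ _*_ d≡fg d≡fg ⟩
        (f * (t * e)) * (f * (t * e)) ≡⟨ lem f t e ⟩
        t * (f * f) * (e * (t * e)) ≡⟨ cong (t * (f * f) *_) s≡eg ⟨
        t * (f * f) * s           ∎)
        where
        lem : ∀ f t e → (f * (t * e)) * (f * (t * e)) ≡ t * (f * f) * (e * (t * e))
        lem = solve-∀
      s≡ : s ≡ 2 * a + t * (f * f)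
      s≡ = cong (2 * a +_) w≡
      te²≡ : t * (e * e) ≡ 2 * a + t * (f * f)
      te²≡ = trans (trans (lem t e) (sym s≡eg)) s≡
        where
        lem : ∀ t e → t * (e * e) ≡ e * (t * e)
        lem = solve-∀
      t∣2 : t ∣ 2
      t∣2 = coprime-factors cop
        ( ∣m+n∣n⇒∣m {t} {a * 2} (subst (t ∣_) (trans te²≡ (cong (_+ t * (f * f)) (*-comm 2 a))) (m∣m*n
            (e * e))) (m∣m*n (f * f))
        , ∣m⇒∣m*n 2 (subst (t ∣_) (sym d≡fg) (∣n⇒∣m*n f (m∣m*n e))))
      t≤2 : t ≤ 2
      t≤2 = ∣⇒≤ t∣2
      conclude : ∀ {t} → t ≤ 2 → t ∣ 2 → s ≡ 2 * a + t * (f * f) → t * (e * e) ≡ 2 * a + t * (f * f) → d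
          ≡ f * (t * e) →
                 Parametrised a d
      conclude {zero} _ 0∣2 _ _ _ = case 0∣⇒≡0 0∣2 of λ ()
      -- If t = 1 then e² = 2 a + f² gives e and f the same parity. Both even contradicts
      -- coprimality; both odd makes 2 a a multiple of 8, although a is odd.
      conclude {suc zero} _ _ _ e²≡ _ = ⊥-elim (absurd (parity e) (parity f) (trans (lem e) (trans e²≡
          (cong (2 * a +_) (sym (lem f))))) cop-ef)
        where
        lem : ∀ e → e * e ≡ 1 * (e * e)
        lem = solve-∀
        absurd : ∀ {e f} → Parity e → Parity f → e * e ≡ 2 * a + f * f → Coprime e f → ⊥
        absurd (even k) (even l) _ c = case c (m∣m*n {2} k , m∣m*n {2} l) of λ ()
        absurd (even k) (odd l) eq _ = even≢odd′ (k * (2 * k)) (a + 2 * l * (l + 1)) (trans (l₁ k)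
            (trans eq (l₂ a l)))
          where
          l₁ : ∀ k → 2 * (k * (2 * k)) ≡ 2 * k * (2 * k)
          l₁ = solve-∀
          l₂ : ∀ a l → 2 * a + (1 + 2 * l) * (1 + 2 * l) ≡ 1 + 2 * (a + 2 * l * (l + 1))
          l₂ = solve-∀
        absurd (odd k) (even l) eq _ = even≢odd′ (a + l * (2 * l)) (2 * k * (k + 1)) (trans (l₁ a l)
            (trans (sym eq) (l₂ k)))
          where
          l₁ : ∀ a l → 2 * (a + l * (2 * l)) ≡ 2 * a + 2 * l * (2 * l)
          l₁ = solve-∀
          l₂ : ∀ k → (1 + 2 * k) * (1 + 2 * k) ≡ 1 + 2 * (2 * k * (k + 1))
          l₂ = solve-∀
        absurd (odd k) (odd l) eq _ with odd-square k | odd-square l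
        ... | u , p | v , q = oa (∣m+n∣n⇒∣m {2} {a} {4 * v} (divides (2 * u) (*-cancelˡ 2 (λ ()) (begin
            2 * (a + 4 * v)     ≡⟨ l₁ a v ⟩
            2 * a + 8 * v       ≡⟨ suc-injective (trans (l₂ a v) (trans (cong (2 * a +_) (sym q)) (trans
                (sym eq) p))) ⟩
            8 * u               ≡⟨ l₃ u ⟩
            2 * (2 * u * 2)     ∎))) (divides (2 * v) (l₄ v)))
          where
          l₁ : ∀ a v → 2 * (a + 4 * v) ≡ 2 * a + 8 * v
          l₁ = solve-∀
          l₂ : ∀ a v → 1 + (2 * a + 8 * v) ≡ 2 * a + (1 + 8 * v)
          l₂ = solve-∀
          l₃ : ∀ u → 8 * u ≡ 2 * (2 * u * 2)
          l₃ = solve-∀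
          l₄ : ∀ v → 4 * v ≡ 2 * v * 2
          l₄ = solve-∀
      conclude {suc (suc zero)} _ _ _ te²≡ d≡ = e , f
        , *-cancelˡ 2 (λ ()) (trans te²≡ (sym (*-distribˡ-+ 2 a (f * f)))) , trans d≡ (lem f e) , cop-ef
        where
        lem : ∀ f e → f * (2 * e) ≡ 2 * (e * f)
        lem = solve-∀
      conclude {suc (suc (suc _))} (s≤s (s≤s ())) _ _ _ _

  -- Infinite descent for a² + d² = c², a² + q² d² = b².

  -- By the parametrisation a = e² - f² = g² - h², d = 2 e f, q d = 2 g h, so g h = q e f. With α = gcd(g, e),
  -- g = β α, e = γ α, f = δ β and h = q γ δ, the equation g² + f² = e² + h² becomes
  -- β² (α² + δ²) = γ² (α² + q² δ²), hence α² + δ² = k γ² and α² + q² δ² = k β² for some k dividing q² - 1.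
  -- If k = 1 this is a smaller solution, as d = 2 α β γ δ.
  module Descent (q r : ℕ) (q²≡1+r : q * q ≡ 1 + r) (2∣q : 2 ∣ q)
    (odd⇒coprime-q : ∀ {n} → Odd n → Coprime n q)
    (only-k≡1 : ∀ k α β γ δ → Odd α → Odd β → Coprime α δ → k ∣ r →
      α * α + δ * δ ≡ k * (γ * γ) → α * α + (q * δ) * (q * δ) ≡ k * (β * β) → k ≡ 1)
    where

    -- A new solution with α and δ in place of a and d. The factorisation of `ef`, with α, β, γ
    -- nonzero, is what bounds δ against d = 2 e f.
    Smaller : ℕ → Set
    Smaller ef = ∃ λ α → ∃ λ β → ∃ λ γ → ∃ λ δ →
      Odd α × Coprime α δ × ef ≡ α * β * γ * δ × α ≢ 0 × β ≢ 0 × γ ≢ 0 ×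
      α * α + δ * δ ≡ γ * γ × α * α + (q * δ) * (q * δ) ≡ β * β

    private
      -- If e were even, f would be odd by coprimality, and g² + f² ≡ 2 modulo 8 would equal a
      -- multiple of 4.
      odd-e : ∀ {e f g h} → Odd g → 2 ∣ h → Coprime e f → g * g + f * f ≡ e * e + h * h → Odd e
      odd-e {f = f} {g} og (divides i refl) cop eq (divides j refl) with parity g | parity f
      ... | even k | _ = og (m∣m*n k)
      ... | _ | even l = case cop (divides j refl , m∣m*n l) of λ ()
      ... | odd k | odd l with odd-square k | odd-square l
      ... | u , p | v , w = even≢odd′ (j * j + i * i) (2 * (u + v)) (*-cancelˡ 2 (λ ()) (begin
        2 * (2 * (j * j + i * i))       ≡⟨ l₁ i j ⟩
        j * 2 * (j * 2) + i * 2 * (i * 2) ≡⟨ eq ⟨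
        (1 + 2 * k) * (1 + 2 * k) + (1 + 2 * l) * (1 + 2 * l) ≡⟨ cong₂ _+_ p w ⟩
        1 + 8 * u + (1 + 8 * v)         ≡⟨ l₂ u v ⟩
        2 * (1 + 2 * (2 * (u + v)))     ∎))
        where
        open ≡-Reasoning
        l₁ : ∀ i j → 2 * (2 * (j * j + i * i)) ≡ j * 2 * (j * 2) + i * 2 * (i * 2)
        l₁ = solve-∀
        l₂ : ∀ u v → 1 + 8 * u + (1 + 8 * v) ≡ 2 * (1 + 2 * (2 * (u + v)))
        l₂ = solve-∀

    module _ {α β γ f h : ℕ} (og : Odd (β * α)) (oe : Odd (γ * α)) (cop-βγ : Coprime β γ)
      (cop-ef : Coprime (γ * α) f) (gh≡ : β * α * h ≡ q * (γ * α * f))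
      (eq : β * α * (β * α) + f * f ≡ γ * α * (γ * α) + h * h) where
      private
        oα : Odd α
        oα = odd-divisor (n∣m*n β) og
        oβ : Odd β
        oβ = odd-divisor (m∣m*n α) og
        oγ : Odd γ
        oγ = odd-divisor (m∣m*n α) oe

        βh≡ : β * h ≡ q * (γ * f)
        βh≡ = *-cancelʳ α (odd≢0 oα) (trans (l₁ α β h) (trans gh≡ (l₂ q γ α f)))
          where
          l₁ : ∀ α β h → β * h * α ≡ β * α * h
          l₁ = solve-∀
          l₂ : ∀ q γ α f → q * (γ * α * f) ≡ q * (γ * f) * α
          l₂ = solve-∀

        -- β is coprime to q, being odd, and to γ, so in β h = q γ f it must divide f.
        β∣f : β ∣ f
        β∣f = coprime-divisor {o = f} cop-βγ (coprime-divisor {o = γ * f} (odd⇒coprime-q oβ)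
                (subst (β ∣_) βh≡ (m∣m*n h)))

      smaller′ : Smaller (γ * α * f)
      smaller′ with β∣f
      ... | divides δ refl = α , β , γ , δ , oα , cop-αδ , l₀ α β γ δ , odd≢0 oα , odd≢0 oβ , odd≢0 oγ
          , unit α²+δ²≡ , unit α²+q²δ²≡
        where
        open ≡-Reasoning
        l₀ : ∀ α β γ δ → γ * α * (δ * β) ≡ α * β * γ * δ
        l₀ = solve-∀
        cop-αδ : Coprime α δ
        cop-αδ (x∣α , x∣δ) = cop-ef (∣n⇒∣m*n γ x∣α , ∣m⇒∣m*n β x∣δ)
        h≡ : h ≡ q * γ * δ
        h≡ = *-cancelˡ β (odd≢0 oβ) (trans βh≡ (l q γ δ β))
          where
          l : ∀ q γ δ β → q * (γ * (δ * β)) ≡ β * (q * γ * δ)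
          l = solve-∀
        X Y : ℕ
        X = α * α + δ * δ
        Y = α * α + (q * δ) * (q * δ)
        β²X≡γ²Y : (β * β) * X ≡ (γ * γ) * Y
        β²X≡γ²Y = begin
          (β * β) * X                               ≡⟨ l₁ α β δ ⟩
          β * α * (β * α) + δ * β * (δ * β)         ≡⟨ eq ⟩
          γ * α * (γ * α) + h * h                   ≡⟨ cong (λ h → γ * α * (γ * α) + h * h) h≡ ⟩
          γ * α * (γ * α) + (q * γ * δ) * (q * γ * δ) ≡⟨ l₂ α γ δ q ⟩
          (γ * γ) * Y                               ∎
          where
          l₁ : ∀ α β δ → (β * β) * (α * α + δ * δ) ≡ β * α * (β * α) + δ * β * (δ * β)
          l₁ = solve-∀
          l₂ : ∀ α γ δ q → γ * α * (γ * α) + (q * γ * δ) * (q * γ * δ) ≡ (γ * γ) * (α * α + (q * δ) * (q * δ))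
          l₂ = solve-∀
        γ²∣X : γ * γ ∣ X
        γ²∣X = coprime-divisor (coprime-squares (Coprimality.sym cop-βγ)) (subst (γ * γ ∣_) (sym β²X≡γ²Y)
            (m∣m*n Y))
        k : ℕ
        k = quotient γ²∣X
        α²+δ²≡ : X ≡ k * (γ * γ)
        α²+δ²≡ = _∣_.equality γ²∣X
        α²+q²δ²≡ : Y ≡ k * (β * β)
        α²+q²δ²≡ = *-cancelˡ (γ * γ) (odd≢0 oγ ∘ reduce ∘ m*n≡0⇒m≡0∨n≡0 γ) (trans (sym β²X≡γ²Y) (trans
            (cong (β * β *_) α²+δ²≡) (l β γ k)))
          where
          l : ∀ β γ k → β * β * (k * (γ * γ)) ≡ γ * γ * (k * (β * β))
          l = solve-∀
        q²δ²≡ : (q * δ) * (q * δ) ≡ δ * δ * r + δ * δ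
        q²δ²≡ = trans (l₁ q δ) (trans (cong (_* (δ * δ)) q²≡1+r) (l₂ r δ))
          where
          l₁ : ∀ q δ → (q * δ) * (q * δ) ≡ q * q * (δ * δ)
          l₁ = solve-∀
          l₂ : ∀ r δ → (1 + r) * (δ * δ) ≡ δ * δ * r + δ * δ
          l₂ = solve-∀
        -- Both Y - X = δ² r and q² X - Y = α² r are multiples of k, and α² and δ² are coprime.
        k∣r : k ∣ r
        k∣r = coprime-factors (coprime-squares cop-αδ)
          ( ∣m+n∣n⇒∣m (subst (k ∣_) (sym α²r≡) (m∣m*n _)) (subst (k ∣_) (sym α²+q²δ²≡) (m∣m*n (β * β)))
          , ∣m+n∣n⇒∣m (subst (k ∣_) (sym δ²r≡) (m∣m*n (β * β))) (subst (k ∣_) (sym α²+δ²≡) (m∣m*n (γ * γ))))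
          where
          δ²r≡ : δ * δ * r + X ≡ k * (β * β)
          δ²r≡ = trans (l (α * α) (δ * δ) (δ * δ * r)) (trans (cong (α * α +_) (sym q²δ²≡)) α²+q²δ²≡)
            where
            l : ∀ a d x → x + (a + d) ≡ a + (x + d)
            l = solve-∀
          α²r≡ : α * α * r + Y ≡ k * ((1 + r) * (γ * γ))
          α²r≡ = begin
            α * α * r + Y                              ≡⟨ cong (λ z → α * α * r + (α * α + z)) q²δ²≡ ⟩
            α * α * r + (α * α + (δ * δ * r + δ * δ))  ≡⟨ l₁ (α * α) (δ * δ) r ⟩
            (1 + r) * X                                ≡⟨ cong ((1 + r) *_) α²+δ²≡ ⟩
            (1 + r) * (k * (γ * γ))                    ≡⟨ l₂ r k (γ * γ) ⟩
            k * ((1 + r) * (γ * γ))                    ∎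
            where
            l₁ : ∀ a d r → a * r + (a + (d * r + d)) ≡ (1 + r) * (a + d)
            l₁ = solve-∀
            l₂ : ∀ r k g → (1 + r) * (k * g) ≡ k * ((1 + r) * g)
            l₂ = solve-∀
        k≡1 : k ≡ 1
        k≡1 = only-k≡1 k α β γ δ oα oβ cop-αδ k∣r α²+δ²≡ α²+q²δ²≡
        unit : ∀ {x y} → x ≡ k * y → x ≡ y
        unit {_} {y} p = trans p (trans (cong (_* y) k≡1) (*-identityˡ y))

    smaller : ∀ {e f g h} → Odd g → 2 ∣ h → Coprime e f → g * h ≡ q * (e * f) →
              g * g + f * f ≡ e * e + h * h → Smaller (e * f)
    smaller {e} {f} {g} {h} og 2∣h cop-ef gh≡ eq with odd-e {e} og 2∣h cop-ef eq | gcd-split g e (odd≢0 og)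
    ... | oe | α , β , γ , refl , refl , cop-βγ = smaller′ og oe cop-βγ cop-ef gh≡ eq

    Trivial : ℕ → Set
    Trivial d = ∀ a b c → Odd a → Coprime a d → a * a + d * d ≡ c * c →
                a * a + (q * d) * (q * d) ≡ b * b → d ≡ 0

    descent : ∀ d → Trivial d
    descent = <-rec Trivial (λ d → step {d})
      where
      step : ∀ {d} → (∀ {d′} → d′ < d → Trivial d′) → Trivial d
      step {d} rec a b c oa cop c² b² = reduce-by (pythagorean {a} {c} {d} oa cop c²)
        (pythagorean {a} {b} {q * d} oa (coprime-* {a} {q} {d} (odd⇒coprime-q oa) cop) b²)
        where
        reduce-by : Parametrised a d → Parametrised a (q * d) → d ≡ 0
        reduce-by (e , f , e² , d≡ , cop-ef) (g , h , g² , qd≡ , cop-gh) = conclude (found (even-factor 2∣gh))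
          where
          open ≡-Reasoning
          gh≡ : g * h ≡ q * (e * f)
          gh≡ = *-cancelˡ 2 (λ ()) (trans (sym qd≡) (trans (cong (q *_) d≡) (l q (e * f))))
            where
            l : ∀ q x → q * (2 * x) ≡ 2 * (q * x)
            l = solve-∀
          2∣gh : 2 ∣ g * h
          2∣gh = subst (2 ∣_) (sym gh≡) (∣m⇒∣m*n (e * f) 2∣q)
          eq : g * g + f * f ≡ e * e + h * h
          eq = trans (cong (_+ f * f) g²) (trans (l a (h * h) (f * f)) (cong (_+ h * h) (sym e²)))
            where
            l : ∀ a x y → a + x + y ≡ a + y + x
            l = solve-∀
          even-factor : 2 ∣ g * h → (Odd g × 2 ∣ h) ⊎ (Odd h × 2 ∣ g)
          even-factor 2∣gh with 2 ∣? g
          ... | yes 2∣g = inj₂ ((λ 2∣h → case cop-gh (2∣g , 2∣h) of λ ()) , 2∣g)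
          ... | no og = inj₁ (og , coprime-divisor (Coprimality.sym (odd⇒coprime-2 og)) 2∣gh)
          found : (Odd g × 2 ∣ h) ⊎ (Odd h × 2 ∣ g) → Smaller (e * f)
          found (inj₁ (og , 2∣h)) = smaller og 2∣h cop-ef gh≡ eq
          -- The equations are invariant under exchanging g with h and e with f simultaneously.
          found (inj₂ (oh , 2∣g)) = subst Smaller (*-comm f e) (smaller oh 2∣g (Coprimality.sym cop-ef)
            (trans (*-comm h g) (trans gh≡ (cong (q *_) (*-comm e f))))
            (trans (+-comm (h * h) (e * e)) (trans (sym eq) (+-comm (g * g) (f * f)))))
          conclude : Smaller (e * f) → d ≡ 0
          conclude (α , β , γ , δ , oα , cop-αδ , ef≡ , α≢0 , β≢0 , γ≢0 , γ² , β²) with δ ≟ 0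
          ... | yes refl = trans d≡ (cong (2 *_) (trans ef≡ (*-zeroʳ (α * β * γ))))
          ... | no δ≢0 = ⊥-elim (δ≢0 (rec δ<d α β γ oα cop-αδ γ² β²))
            where
            instance
              _ = ≢-nonZero α≢0
              _ = ≢-nonZero β≢0
              _ = ≢-nonZero γ≢0
              _ = ≢-nonZero δ≢0
              _ = m*n≢0 α β
              _ = m*n≢0 (α * β) γ
            -- Since d = 2 α β γ δ, it is at least δ + δ, which exceeds δ.
            δ<d : δ < d
            δ<d = subst (δ <_) (sym (trans d≡ (cong (2 *_) ef≡))) (<-≤-trans (m<m+n δ (n≢0⇒n>0 δ≢0))
              (subst (δ + δ ≤_) (l (α * β * γ * δ)) (+-mono-≤ (m≤n*m δ (α * β * γ)) (m≤n*m δ (α * β * γ)))))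
              where
              l : ∀ x → x + x ≡ 2 * x
              l = solve-∀

  -- The common factor k for q = 2 and for q = 4.

  -- The other divisor k = 3 would divide α² + δ² with α and δ coprime.
  only-1∣3 : ∀ k α β γ δ → Odd α → Odd β → Coprime α δ → k ∣ 3 →
    α * α + δ * δ ≡ k * (γ * γ) → α * α + (2 * δ) * (2 * δ) ≡ k * (β * β) → k ≡ 1
  only-1∣3 k α β γ δ _ _ cop k∣3 X _ = cases k k∣3 X
    where
    cases : ∀ k → k ∣ 3 → α * α + δ * δ ≡ k * (γ * γ) → k ≡ 1
    cases 1 _ _ = refl
    cases 3 _ X = ⊥-elim (3∤coprime-squares α δ cop (subst (3 ∣_) (sym X) (m∣m*n (γ * γ))))
    cases 0 d _ = ⊥-elim (from-no (0 ∣? 3) d)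
    cases 2 d _ = ⊥-elim (from-no (2 ∣? 3) d)
    cases (suc (suc (suc (suc _)))) d _ = ⊥-elim (from-no (4 ≤? 3) (≤-trans (m≤m+n 4 _) (∣⇒≤ d)))

  -- The divisors 3 and 15 share one case because the same argument modulo 3 excludes them. The
  -- check is a finite search below 16.
  divisors-15 : ∀ {k} → k ∣ 15 → k ≡ 1 ⊎ k ≡ 5 ⊎ 3 ∣ k
  divisors-15 {k} k∣15 = subst (λ k → k ∣ 15 → P k) (Fin.toℕ-fromℕ< k<16)
    (from-yes (Fin.all? {16} (λ i → (toℕ i ∣? 15) →-dec P? (toℕ i))) (fromℕ< k<16)) k∣15
    where
    P : ℕ → Set
    P k = k ≡ 1 ⊎ k ≡ 5 ⊎ 3 ∣ k
    P? : ∀ k → Dec (P k)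
    P? k = (k ≟ 1) ⊎-dec ((k ≟ 5) ⊎-dec (3 ∣? k))
    k<16 : k < 16
    k<16 = s≤s (∣⇒≤ k∣15)

  -- Multiples of 3 are excluded by α² + δ² modulo 3. For k = 5, α² + 16 δ² ≡ 1 but 5 β² ≡ 5 modulo
  -- 8.
  only-1∣15 : ∀ k α β γ δ → Odd α → Odd β → Coprime α δ → k ∣ 15 →
    α * α + δ * δ ≡ k * (γ * γ) → α * α + (4 * δ) * (4 * δ) ≡ k * (β * β) → k ≡ 1
  only-1∣15 k α β γ δ oα oβ cop k∣15 X Y = cases (divisors-15 k∣15)
    where
    open ≡-Reasoning
    l₁ : ∀ u δ → 1 + 4 * (2 * (u + 2 * (δ * δ))) ≡ 1 + 8 * u + (4 * δ) * (4 * δ)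
    l₁ = solve-∀
    l₂ : ∀ v → 5 * (1 + 8 * v) ≡ 1 + 4 * (1 + 2 * (5 * v))
    l₂ = solve-∀
    k≢5 : ∀ {α β} → Parity α → Parity β → Odd α → Odd β → ¬ (α * α + (4 * δ) * (4 * δ) ≡ 5 * (β * β))
    k≢5 (even i) _ oα _ _ = oα (m∣m*n i)
    k≢5 _ (even j) _ oβ _ = oβ (m∣m*n j)
    k≢5 (odd i) (odd j) _ _ Y = mod-8 (odd-square i) (odd-square j)
      where
      mod-8 : (∃ λ u → (1 + 2 * i) * (1 + 2 * i) ≡ 1 + 8 * u) → (∃ λ v → (1 + 2 * j) * (1 + 2 * j) ≡ 1
          + 8 * v) → ⊥
      mod-8 (u , p) (v , w) = even≢odd′ (u + 2 * (δ * δ)) (5 * v) (*-cancelˡ 4 (λ ()) (suc-injective (begin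
        1 + 4 * (2 * (u + 2 * (δ * δ)))    ≡⟨ l₁ u δ ⟩
        1 + 8 * u + (4 * δ) * (4 * δ)      ≡⟨ cong (_+ (4 * δ) * (4 * δ)) p ⟨
        (1 + 2 * i) * (1 + 2 * i) + (4 * δ) * (4 * δ) ≡⟨ Y ⟩
        5 * ((1 + 2 * j) * (1 + 2 * j))    ≡⟨ cong (5 *_) w ⟩
        5 * (1 + 8 * v)                    ≡⟨ l₂ v ⟩
        1 + 4 * (1 + 2 * (5 * v))          ∎)))
    cases : k ≡ 1 ⊎ k ≡ 5 ⊎ 3 ∣ k → k ≡ 1
    cases (inj₁ k≡1) = k≡1
    cases (inj₂ (inj₂ 3∣k)) = ⊥-elim (3∤coprime-squares α δ cop (subst (3 ∣_) (sym X) (∣m⇒∣m*n (γ * γ) 3∣k)))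
    cases (inj₂ (inj₁ refl)) = ⊥-elim (k≢5 (parity α) (parity β) oα oβ Y)

  odd⇒coprime-4 : ∀ {n} → Odd n → Coprime n 4
  odd⇒coprime-4 {n} on = coprime-* {n} {2} {2} (odd⇒coprime-2 on) (odd⇒coprime-2 on)

  module Descent₂ = Descent 2 3 refl ∣-refl odd⇒coprime-2 only-1∣3
  module Descent₄ = Descent 4 15 refl (divides 2 refl) odd⇒coprime-4 only-1∣15

  -- From the descent to coprime solutions without a parity condition.

  -- After division by gcd(v, w), the remaining v′ divides w′² and is coprime to it, so v′ = 1.
  square-divides : ∀ {v n w} → v ≢ 0 → v * v * n ≡ w * w → ∃ λ c → n ≡ c * c
  square-divides {v} {n} {w} v≢0 eq with gcd-split v w v≢0
  ... | g , v′ , w′ , refl , refl , cop = w′ , (begin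
    n               ≡⟨ *-identityˡ n ⟨
    1 * n           ≡⟨ cong (λ x → x * x * n) v′≡1 ⟨
    v′ * v′ * n     ≡⟨ eq′ ⟩
    w′ * w′         ∎)
    where
    open ≡-Reasoning
    g≢0 : g ≢ 0
    g≢0 = *≢0ʳ v′ v≢0
    eq′ : v′ * v′ * n ≡ w′ * w′
    eq′ = *-cancelʳ (g * g) (g≢0 ∘ reduce ∘ m*n≡0⇒m≡0∨n≡0 g) (trans (l₁ v′ g n) (trans eq (l₂ w′ g)))
      where
      l₁ : ∀ v g n → v * v * n * (g * g) ≡ v * g * (v * g) * n
      l₁ = solve-∀
      l₂ : ∀ w g → w * g * (w * g) ≡ w * w * (g * g)
      l₂ = solve-∀
    v′≡1 : v′ ≡ 1
    v′≡1 = coprime-* {v′} {w′} {w′} cop cop (∣-refl , subst (v′ ∣_) eq′ (∣m⇒∣m*n n (m∣m*n v′)))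

  -- If p is even then 4 divides p, and p² + (q m)² = □ and p² + m² = □ exchange their roles after division by q.
  module Concordant (q : ℕ) (q≢0 : q ≢ 0) (q∣4 : q ∣ 4)
    (descent : ∀ d a b c → Odd a → Coprime a d → a * a + d * d ≡ c * c → a * a + (q * d) * (q * d)
        ≡ b * b → d ≡ 0)
    where

    private
      -- Both m and c are odd, so 8 divides p² = c² - m² and p / 2 is even.
      4∣even : ∀ {p m c} → Odd m → p * p + m * m ≡ c * c → 2 ∣ p → 4 ∣ p
      4∣even {m = m} {c} om c² (divides i refl) with parity m | parity c
      ... | even j | _ = ⊥-elim (om (m∣m*n j))
      ... | odd j | even k = ⊥-elim (even≢odd′ (k * (2 * k)) (2 * (i * i) + 2 * j * (j + 1)) (trans
          (l₁ k) (trans (sym c²) (l₂ i j))))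
        where
        l₁ : ∀ k → 2 * (k * (2 * k)) ≡ 2 * k * (2 * k)
        l₁ = solve-∀
        l₂ : ∀ i j → i * 2 * (i * 2) + (1 + 2 * j) * (1 + 2 * j) ≡ 1 + 2 * (2 * (i * i) + 2 * j * (j + 1))
        l₂ = solve-∀
      ... | odd j | odd k with odd-square j | odd-square k
      ... | u , x | v , y with parity i
      ... | even s = divides s (l s)
        where
        l : ∀ s → 2 * s * 2 ≡ s * 4
        l = solve-∀
      ... | odd s = ⊥-elim (even≢odd′ v (2 * s * (s + 1) + u) (*-cancelˡ 4 (λ ()) (suc-injective (begin
        1 + 4 * (2 * v)                       ≡⟨ l₁ v ⟩
        1 + 8 * v                             ≡⟨ y ⟨
        (1 + 2 * k) * (1 + 2 * k)             ≡⟨ c² ⟨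
        (1 + 2 * s) * 2 * ((1 + 2 * s) * 2) + (1 + 2 * j) * (1 + 2 * j) ≡⟨ cong ((1 + 2 * s) * 2 * ((1
            + 2 * s) * 2) +_) x ⟩
        (1 + 2 * s) * 2 * ((1 + 2 * s) * 2) + (1 + 8 * u) ≡⟨ l₂ s u ⟩
        1 + 4 * (1 + 2 * (2 * s * (s + 1) + u)) ∎))))
        where
        open ≡-Reasoning
        l₁ : ∀ v → 1 + 4 * (2 * v) ≡ 1 + 8 * v
        l₁ = solve-∀
        l₂ : ∀ s u → (1 + 2 * s) * 2 * ((1 + 2 * s) * 2) + (1 + 8 * u) ≡ 1 + 4 * (1 + 2 * (2 * s * (s + 1) + u))
        l₂ = solve-∀

    concordant⇒0 : ∀ {p m b c} → m ≢ 0 → Coprime p m → p * p + m * m ≡ c * c →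
                   p * p + (q * m) * (q * m) ≡ b * b → p ≡ 0
    concordant⇒0 {p} {m} {b} {c} m≢0 cop c² b² with 2 ∣? p
    ... | no op = ⊥-elim (m≢0 (descent m p b c op cop c² b²))
    ... | yes 2∣p = exchange (∣-trans q∣4 (4∣even {p} {m} {c} om c² 2∣p))
      where
      om : Odd m
      om 2∣m = case cop (2∣p , 2∣m) of λ ()
      exchange : q ∣ p → p ≡ 0
      exchange (divides p′ refl) with square-divides {q} {m * m + p′ * p′} {b} q≢0 (trans (l p′ q m) b²)
        where
        l : ∀ p q m → q * q * (m * m + p * p) ≡ p * q * (p * q) + (q * m) * (q * m)
        l = solve-∀
      ... | c′ , eq = cong (_* q) (descent p′ m c c′ om
        (λ (x∣m , x∣p′) → cop (∣m⇒∣m*n q x∣p′ , x∣m)) eq (trans (l p′ q m) c²))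
        where
        l : ∀ p q m → m * m + (q * p) * (q * p) ≡ p * q * (p * q) + m * m
        l = solve-∀

  module Concordant₂ = Concordant 2 (λ ()) (divides 2 refl) Descent₂.descent
  module Concordant₄ = Concordant 4 (λ ()) ∣-refl Descent₄.descent

-- Transfer from ℕ to ℚ.

open Natural using (square-divides; module Concordant₂; module Concordant₄)

open import Data.Integer as ℤ using (+_; -[1+_])
import Data.Integer.Properties as ℤ
open import Data.Rational hiding (∣_∣)
open import Data.Rational.Properties
open import Data.Rational.Unnormalised as ℚᵘ using (mkℚᵘ; *≡*)
import Data.Rational.Unnormalised.Properties as ℚᵘ
open import Tactic.RingSolver using (solve-∀)
open import Tactic.RingSolver.Core.AlmostCommutativeRing using (AlmostCommutativeRing; fromCommutativeRing)

ℚ-ring : AlmostCommutativeRing 0ℓ 0ℓ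
ℚ-ring = fromCommutativeRing +-*-commutativeRing (λ x → dec⇒maybe (0ℚ ≟ x))

square-abs : ∀ i → i ℤ.* i ≡ + (ℤ.∣ i ∣ ℕ.* ℤ.∣ i ∣)
square-abs (+ n)    = sym (ℤ.pos-* n n)
square-abs -[1+ n ] = refl

-- Equality of unnormalised fractions is cross-multiplication in ℤ, free of the gcd reductions
-- inside the operations of ℚ.
unnormalised-equation : ∀ r s n → r * r + [ n ]ℚ ≡ s * s →
  toℚᵘ r ℚᵘ.* toℚᵘ r ℚᵘ.+ mkℚᵘ (+ n) 0 ℚᵘ.≃ toℚᵘ s ℚᵘ.* toℚᵘ s
unnormalised-equation r s n eq = begin
  toℚᵘ r ℚᵘ.* toℚᵘ r ℚᵘ.+ mkℚᵘ (+ n) 0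
    ≈⟨ ℚᵘ.+-cong (toℚᵘ-homo-* r r) (toℚᵘ-fromℚᵘ (mkℚᵘ (+ n) 0)) ⟨
  toℚᵘ (r * r) ℚᵘ.+ toℚᵘ [ n ]ℚ
    ≈⟨ toℚᵘ-homo-+ (r * r) [ n ]ℚ ⟨
  toℚᵘ (r * r + [ n ]ℚ)
    ≡⟨ cong toℚᵘ eq ⟩
  toℚᵘ (s * s)
    ≈⟨ toℚᵘ-homo-* s s ⟩
  toℚᵘ s ℚᵘ.* toℚᵘ s ∎
  where open import Relation.Binary.Reasoning.Setoid ℚᵘ.≃-setoid

-- For |r| = p / m and |s| = u / v, clearing denominators gives v² (p² + n m²) = (u m)², to which
-- `square-divides` applies.
square-sum : ∀ r s n → r * r + [ n ]ℚ ≡ s * s →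
  ∃ λ c → ℤ.∣ ↥ r ∣ ℕ.* ℤ.∣ ↥ r ∣ ℕ.+ n ℕ.* (↧ₙ r ℕ.* ↧ₙ r) ≡ c ℕ.* c
square-sum r@(mkℚ i m-1 _) s@(mkℚ j v-1 _) n eq with unnormalised-equation r s n eq
... | *≡* eq′ = square-divides {suc v-1} {w = ℤ.∣ j ∣ ℕ.* suc m-1} (λ ())
    (trans (trans (lem₁ p m v n) (ℤ.+-injective (trans (sym lhs) (trans eq′ rhs)))) (lem₂ m u))
  where
  p = ℤ.∣ i ∣
  u = ℤ.∣ j ∣
  m = suc m-1
  v = suc v-1
  lhs : (i ℤ.* i ℤ.* + 1 ℤ.+ + n ℤ.* + (m ℕ.* m)) ℤ.* + (v ℕ.* v)
        ≡ + ((p ℕ.* p ℕ.* 1 ℕ.+ n ℕ.* (m ℕ.* m)) ℕ.* (v ℕ.* v))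
  lhs = begin
    (i ℤ.* i ℤ.* + 1 ℤ.+ + n ℤ.* + (m ℕ.* m)) ℤ.* + (v ℕ.* v)
      ≡⟨ cong (λ x → (x ℤ.* + 1 ℤ.+ + n ℤ.* + (m ℕ.* m)) ℤ.* + (v ℕ.* v)) (square-abs i) ⟩
    (+ (p ℕ.* p) ℤ.* + 1 ℤ.+ + n ℤ.* + (m ℕ.* m)) ℤ.* + (v ℕ.* v)
      ≡⟨ cong (ℤ._* + (v ℕ.* v)) (cong₂ ℤ._+_ (ℤ.pos-* (p ℕ.* p) 1) (ℤ.pos-* n (m ℕ.* m))) ⟨
    + (p ℕ.* p ℕ.* 1 ℕ.+ n ℕ.* (m ℕ.* m)) ℤ.* + (v ℕ.* v)
      ≡⟨ ℤ.pos-* (p ℕ.* p ℕ.* 1 ℕ.+ n ℕ.* (m ℕ.* m)) (v ℕ.* v) ⟨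
    + ((p ℕ.* p ℕ.* 1 ℕ.+ n ℕ.* (m ℕ.* m)) ℕ.* (v ℕ.* v)) ∎
    where open ≡-Reasoning
  rhs : j ℤ.* j ℤ.* + (m ℕ.* m ℕ.* 1) ≡ + (u ℕ.* u ℕ.* (m ℕ.* m ℕ.* 1))
  rhs = trans (cong (ℤ._* + (m ℕ.* m ℕ.* 1)) (square-abs j)) (sym (ℤ.pos-* (u ℕ.* u) (m ℕ.* m ℕ.* 1)))
  lem₁ : ∀ p m v n → v ℕ.* v ℕ.* (p ℕ.* p ℕ.+ n ℕ.* (m ℕ.* m)) ≡ (p ℕ.* p ℕ.* 1 ℕ.+ n ℕ.* (m ℕ.* m)) ℕ.*
      (v ℕ.* v)
  lem₁ = ℕ-Solver.solve-∀
  lem₂ : ∀ m u → u ℕ.* u ℕ.* (m ℕ.* m ℕ.* 1) ≡ u ℕ.* m ℕ.* (u ℕ.* m)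
  lem₂ = ℕ-Solver.solve-∀

-- The numerator and denominator of the reduced fraction r serve as p and m. Their coprimality is an
-- irrelevant field and has to be recomputed.
concordant-ratio : (q : ℕ) →
  (∀ {p m b c} → m ≢ 0 → Coprime p m → p ℕ.* p ℕ.+ m ℕ.* m ≡ c ℕ.* c →
     p ℕ.* p ℕ.+ (q ℕ.* m) ℕ.* (q ℕ.* m) ≡ b ℕ.* b → p ≡ 0) →
  ∀ r s t → r * r + [ 1 ]ℚ ≡ s * s → r * r + [ q ℕ.* q ]ℚ ≡ t * t → r ≡ 0ℚ
concordant-ratio q concordant⇒0 r@(mkℚ i m-1 cop) s t s² t² with square-sum r s 1 s² | square-sum r t
    (q ℕ.* q) t²
... | c , c² | b , b² = ↥p≡0⇒p≡0 r (ℤ.∣i∣≡0⇒i≡0 (concordant⇒0 {ℤ.∣ i ∣} {suc m-1} {b} {c} (λ ())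
  (Coprimality.recompute cop) (trans (cong (ℤ.∣ i ∣ ℕ.* ℤ.∣ i ∣ ℕ.+_) (sym (ℕ.*-identityˡ _))) c²)
  (trans (cong (ℤ.∣ i ∣ ℕ.* ℤ.∣ i ∣ ℕ.+_) (lem q (suc m-1))) b²)))
  where
  lem : ∀ q m → (q ℕ.* m) ℕ.* (q ℕ.* m) ≡ q ℕ.* q ℕ.* (m ℕ.* m)
  lem = ℕ-Solver.solve-∀

square⇒ℕ-square : ∀ s n → s * s ≡ [ n ]ℚ → ∃ λ c → n ≡ c ℕ.* c
square⇒ℕ-square s n eq with square-sum 0ℚ s n (trans (+-identityˡ [ n ]ℚ) (sym eq))
... | c , c² = c , trans (sym (ℕ.*-identityʳ n)) c²

square-nonNeg : ∀ s → 0ℚ ≤ s * s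
square-nonNeg s@(mkℚ (+ _) _ _) = nonNegative⁻¹ (s * s) {{nonNeg*nonNeg⇒nonNeg s s}}
square-nonNeg s@(mkℚ -[1+ _ ] _ _) = subst (0ℚ ≤_) (lem s)
  (nonNegative⁻¹ (- s * - s) {{nonNeg*nonNeg⇒nonNeg (- s) (- s)}})
  where
  lem : ∀ s → - s * - s ≡ s * s
  lem = solve-∀ ℚ-ring

square≢neg : ∀ s p → .{{Negative p}} → s * s ≢ p
square≢neg s p = nonNeg≢neg (s * s) p {{nonNegative (square-nonNeg s)}}

p*q≡0⇒p≡0∨q≡0 : ∀ p q → p * q ≡ 0ℚ → p ≡ 0ℚ ⊎ q ≡ 0ℚ
p*q≡0⇒p≡0∨q≡0 p q pq≡0 with p ≟ 0ℚ
... | yes p≡0 = inj₁ p≡0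
... | no p≢0 = inj₂ (begin
  q              ≡⟨ *-identityˡ q ⟨
  1ℚ * q         ≡⟨ cong (_* q) (*-inverseˡ p) ⟨
  1/ p * p * q   ≡⟨ *-assoc (1/ p) p q ⟩
  1/ p * (p * q) ≡⟨ cong (1/ p *_) pq≡0 ⟩
  1/ p * 0ℚ      ≡⟨ *-zeroʳ (1/ p) ⟩
  0ℚ             ∎)
  where
  open ≡-Reasoning
  instance
    _ = ≢-nonZero p≢0

-- by (kill h₁ k₁ ⊞ kill h₂ k₂ ⊞ …) reduces an equation to the ring identity saying that its two sides differ
-- by the linear combination Σ kᵢ (xᵢ - yᵢ) of the hypotheses hᵢ : xᵢ ≡ yᵢ.
infixl 6 _⊞_

kill : ∀ {x y} → x ≡ y → (k : ℚ) → k * (x - y) ≡ 0ℚ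
kill {x} refl k = trans (cong (k *_) (+-inverseʳ x)) (*-zeroʳ k)

_⊞_ : ∀ {x y} → x ≡ 0ℚ → y ≡ 0ℚ → x + y ≡ 0ℚ
refl ⊞ refl = refl

by : ∀ {x y z} → z ≡ 0ℚ → x ≡ y + z → x ≡ y
by {y = y} refl eq = trans eq (+-identityʳ y)

-- The homogeneous form of the statement about ratios: divide by d² and take r = a / d.
concordant : (q : ℕ) →
  (∀ r s t → r * r + [ 1 ]ℚ ≡ s * s → r * r + [ q ℕ.* q ]ℚ ≡ t * t → r ≡ 0ℚ) →
  ∀ a d c b → a * a + d * d ≡ c * c → a * a + [ q ℕ.* q ]ℚ * (d * d) ≡ b * b → a ≡ 0ℚ ⊎ d ≡ 0ℚ
concordant q ratio a d c b c² b² with d ≟ 0ℚ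
... | yes d≡0 = inj₂ d≡0
... | no d≢0 = inj₁ (by (kill ai≡0 d ⊞ kill id≡1 (- a)) (lem₂ a d i))
  where
  instance
    _ = ≢-nonZero d≢0
  i = 1/ d
  id≡1 : i * d ≡ 1ℚ
  id≡1 = *-inverseˡ d
  lem₁ : ∀ a d c i n → (a * i) * (a * i) + n ≡ (c * i) * (c * i)
         + (i * i * (a * a + n * (d * d) - c * c) + - n * (i * d + 1ℚ) * (i * d - 1ℚ))
  lem₁ = solve-∀ ℚ-ring
  lem₂ : ∀ a d i → a ≡ 0ℚ + (d * (a * i - 0ℚ) + - a * (i * d - 1ℚ))
  lem₂ = solve-∀ ℚ-ring
  ai≡0 : a * i ≡ 0ℚ
  ai≡0 = ratio (a * i) (c * i) (b * i)
    (by (kill (trans (cong (λ x → a * a + x) (*-identityˡ (d * d))) c²) (i * i)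
        ⊞ kill id≡1 (- [ 1 ]ℚ * (i * d + 1ℚ))) (lem₁ a d c i [ 1 ]ℚ))
    (by (kill b² (i * i) ⊞ kill id≡1 (- [ q ℕ.* q ]ℚ * (i * d + 1ℚ))) (lem₁ a d b i [ q ℕ.* q ]ℚ))

concordant₂ : ∀ a d c b → a * a + d * d ≡ c * c → a * a + [ 4 ]ℚ * (d * d) ≡ b * b → a ≡ 0ℚ ⊎ d ≡ 0ℚ
concordant₂ = concordant 2 (concordant-ratio 2 (λ {p} {m} {b} {c} → Concordant₂.concordant⇒0 {p} {m} {b} {c}))

concordant₄ : ∀ a d c b → a * a + d * d ≡ c * c → a * a + [ 16 ]ℚ * (d * d) ≡ b * b → a ≡ 0ℚ ⊎ d ≡ 0ℚ
concordant₄ = concordant 4 (concordant-ratio 4 (λ {p} {m} {b} {c} → Concordant₄.concordant⇒0 {p} {m} {b} {c}))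

-- Rational points on y² = F_A(x²) and on w² = F_A(X) F_B(X).

-- This is F_A(X), quartic in x for X = x². Indeed (5 X - 1)(X + 3) = 5 X² + 14 X - 3 and -(3 X +
-- 1)(X - 5) = -3 X² + 14 X + 5.
quartic : ℚ → ℚ → ℚ → ℚ
quartic A B X = A * (X * X) + [ 14 ]ℚ * X + B

p-q≡0⇒p≡q : ∀ {p q} → p - q ≡ 0ℚ → p ≡ q
p-q≡0⇒p≡q {p} {q} eq = trans (lem p q) (trans (cong (λ x → q + x) eq) (+-identityʳ q))
  where
  lem : ∀ p q → p ≡ q + (p - q)
  lem = solve-∀ ℚ-ring

*-cancel-≢0 : ∀ p {q} → p ≢ 0ℚ → p * q ≡ 0ℚ → q ≡ 0ℚ
*-cancel-≢0 p {q} p≢0 pq≡0 = [ (λ p≡0 → ⊥-elim (p≢0 p≡0)) , id ]′ (p*q≡0⇒p≡0∨q≡0 p q pq≡0)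

between-squares : ∀ k n → k ℕ.* k ℕ.< n → n ℕ.< suc k ℕ.* suc k → NonSquare [ n ]ℚ
between-squares k n k²<n n<[1+k]² s s²≡n = absurd (square⇒ℕ-square s n s²≡n)
  where
  absurd : ¬ (∃ λ c → n ≡ c ℕ.* c)
  absurd (c , refl) with c ℕ.≤? k
  ... | yes c≤k = ℕ.<⇒≱ k²<n (ℕ.*-mono-≤ c≤k c≤k)
  ... | no c≰k = ℕ.<⇒≱ n<[1+k]² (ℕ.*-mono-≤ (ℕ.≰⇒> c≰k) (ℕ.≰⇒> c≰k))

-- The real and imaginary parts of y² = quartic A B (x²) for x = a + b√d and y = y₀ + y₁√d.
Lies-on : (A B d a b y₀ y₁ : ℚ) → Set
Lies-on A B d a b y₀ y₁ = let D = d * (b * b) ; s = a * a + D in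
  y₀ * y₀ + d * (y₁ * y₁) ≡ A * (s * s + [ 4 ]ℚ * (a * a * D)) + [ 14 ]ℚ * s + B
  × y₀ * y₁ ≡ b * ([ 2 ]ℚ * (A * (a * s)) + [ 14 ]ℚ * a)

-- The relation A² = 2 A + 15 says that A is 5 or -3. Arguing from it treats both quartics at once.
module Quartic (A : ℚ) (A² : A * A ≡ [ 2 ]ℚ * A + [ 15 ]ℚ)
  (A-nonsquare : NonSquare A) (B-nonsquare : NonSquare ([ 2 ]ℚ - A)) where

  B : ℚ
  B = [ 2 ]ℚ - A

  AB≡-15 : A * B ≡ - [ 15 ]ℚ
  AB≡-15 = by (kill A² (- 1ℚ)) (lem A)
    where
    lem : ∀ A → A * ([ 2 ]ℚ - A) ≡ - [ 15 ]ℚ + - 1ℚ * (A * A - ([ 2 ]ℚ * A + [ 15 ]ℚ))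
    lem = solve-∀ ℚ-ring

  -- F_A(X) = (A X - 1)(X - B), because A B = -15.
  quartic≡0 : ∀ {X} → quartic A B X ≡ 0ℚ → A * X ≡ 1ℚ ⊎ X ≡ B
  quartic≡0 {X} eq = Sum.map p-q≡0⇒p≡q p-q≡0⇒p≡q (p*q≡0⇒p≡0∨q≡0 (A * X - 1ℚ) (X - B)
    (by (kill eq 1ℚ ⊞ kill A² X) (lem A X)))
    where
    lem : ∀ A X → let B = [ 2 ]ℚ - A in (A * X - 1ℚ) * (X - B) ≡ 0ℚ +
      (1ℚ * (A * (X * X) + [ 14 ]ℚ * X + B - 0ℚ) + X * (A * A - ([ 2 ]ℚ * A + [ 15 ]ℚ)))
    lem = solve-∀ ℚ-ring

  -- For X = x² the curve gives (y² - 16 X)² + (2 x y)² = (A X² - B)², and (y² - 16 X)² + 16 (2 x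
  -- y)² = (y² + 16 X)² always holds. Hence x y = 0, which the nonsquares exclude, or y² = 16 X,
  -- which reads (X - 1)(A X - B) = 0. There A X = B would make (A x)² = A B negative.
  rational-points : ∀ x y → y * y ≡ quartic A B (x * x) → x * x ≡ 1ℚ
  rational-points x y eq = cases (concordant₄ (y * y - [ 16 ]ℚ * X) ([ 2 ]ℚ * (y * x)) (A * (X * X) - B)
      (y * y + [ 16 ]ℚ * X)
      (by (kill eq (y * y + quartic A B X - [ 28 ]ℚ * X)
          ⊞ kill A² (- [ 4 ]ℚ * (X * X))) (lem₁ A x y)) (lem₂ x y))
    where
    X = x * x
    lem₁ : ∀ A x y → let B = [ 2 ]ℚ - A ; X = x * x ; F = A * (X * X) + [ 14 ]ℚ * X + B in
      (y * y - [ 16 ]ℚ * X) * (y * y - [ 16 ]ℚ * X) + [ 2 ]ℚ * (y * x) * ([ 2 ]ℚ * (y * x))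
      ≡ (A * (X * X) - B) * (A * (X * X) - B)
        + ((y * y + F - [ 28 ]ℚ * X) * (y * y - F) + - [ 4 ]ℚ * (X * X) * (A * A - ([ 2 ]ℚ * A + [ 15 ]ℚ)))
    lem₁ = solve-∀ ℚ-ring
    lem₂ : ∀ x y → let X = x * x in
      (y * y - [ 16 ]ℚ * X) * (y * y - [ 16 ]ℚ * X) + [ 16 ]ℚ * ([ 2 ]ℚ * (y * x) * ([ 2 ]ℚ * (y * x)))
      ≡ (y * y + [ 16 ]ℚ * X) * (y * y + [ 16 ]ℚ * X)
    lem₂ = solve-∀ ℚ-ring
    lem₃ : ∀ A x y → let B = [ 2 ]ℚ - A ; X = x * x in
      (X - 1ℚ) * (A * X - B) ≡ 0ℚ + (1ℚ * (y * y - [ 16 ]ℚ * X - 0ℚ) + - 1ℚ * (y * y - (A * (X * X)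
          + [ 14 ]ℚ * X + B)))
    lem₃ = solve-∀ ℚ-ring
    lem₄ : ∀ A x → A * x * (A * x) ≡ A * (A * (x * x))
    lem₄ = solve-∀ ℚ-ring
    cases′ : A * X - B ≡ 0ℚ → ⊥
    cases′ eq′ = square≢neg (A * x) (- [ 15 ]ℚ) (trans (lem₄ A x) (trans (cong (A *_) (p-q≡0⇒p≡q eq′)) AB≡-15))
    y≢0 : y ≢ 0ℚ
    y≢0 y≡0 = [ (λ AX≡1 → A-nonsquare (A * x) (trans (lem₄ A x) (trans (cong (A *_) AX≡1) (*-identityʳ A))))
              , B-nonsquare x ]′ (quartic≡0 (trans (sym eq) (cong (λ y → y * y) y≡0)))
    x≢0 : x ≢ 0ℚ
    x≢0 x≡0 = B-nonsquare y (trans eq (trans (cong (λ x → quartic A B (x * x)) x≡0) (lem A B)))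
      where
      lem : ∀ A B → A * 0ℚ + 0ℚ + B ≡ B
      lem = solve-∀ ℚ-ring
    cases : y * y - [ 16 ]ℚ * X ≡ 0ℚ ⊎ [ 2 ]ℚ * (y * x) ≡ 0ℚ → X ≡ 1ℚ
    cases (inj₁ y²≡16X) = [ p-q≡0⇒p≡q , (λ eq′ → ⊥-elim (cases′ eq′)) ]′
      (p*q≡0⇒p≡0∨q≡0 (X - 1ℚ) (A * X - B) (by (kill y²≡16X 1ℚ ⊞ kill eq (- 1ℚ)) (lem₃ A x y)))
    cases (inj₂ 2yx≡0) with p*q≡0⇒p≡0∨q≡0 [ 2 ]ℚ (y * x) 2yx≡0
    ... | inj₂ yx≡0 = ⊥-elim ([ y≢0 , x≢0 ]′ (p*q≡0⇒p≡0∨q≡0 y x yx≡0))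

  -- With m and n as below, F_A(X) F_B(X) = (n² - m²) (n² - 9 m²), which is both (n² - 3 m²)² - (2 m n)² and
  -- (n² + 3 m²)² - 4 (2 m n)².
  product-rational-points : ∀ X w → w * w ≡ quartic A B X * quartic B A X → w ≡ 0ℚ ⊎ X * X ≡ 1ℚ
  product-rational-points X w eq = Sum.map₂ X²≡1 (concordant₂ w ([ 4 ]ℚ * (X * X - 1ℚ)) (n * n - [ 3 ]ℚ *
      (m * m)) (n * n + [ 3 ]ℚ * (m * m))
      (by (kill eq 1ℚ ⊞ kill A² k) (lem₁ A X w)) (by (kill eq 1ℚ ⊞ kill A² k) (lem₂ A X w)))
    where
    m = X - 1ℚ
    n = [ 2 ]ℚ * (X + 1ℚ)
    k = - ((X * X - 1ℚ) * (X * X - 1ℚ))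
    lem₁ : ∀ A X w → let B = [ 2 ]ℚ - A ; m = X - 1ℚ ; n = [ 2 ]ℚ * (X + 1ℚ) ; d = [ 4 ]ℚ * (X * X - 1ℚ) ; c = n * n - [ 3 ]ℚ * (m * m) in
      w * w + d * d ≡ c * c
       + (1ℚ * (w * w - (A * (X * X) + [ 14 ]ℚ * X + B) * (B * (X * X) + [ 14 ]ℚ * X + A)) + -
           ((X * X - 1ℚ) * (X * X - 1ℚ)) * (A * A - ([ 2 ]ℚ * A + [ 15 ]ℚ)))
    lem₁ = solve-∀ ℚ-ring
    lem₂ : ∀ A X w → let B = [ 2 ]ℚ - A ; m = X - 1ℚ ; n = [ 2 ]ℚ * (X + 1ℚ) ; d = [ 4 ]ℚ * (X * X - 1ℚ) ; c = n * n + [ 3 ]ℚ * (m * m) in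
      w * w + [ 4 ]ℚ * (d * d) ≡ c * c
       + (1ℚ * (w * w - (A * (X * X) + [ 14 ]ℚ * X + B) * (B * (X * X) + [ 14 ]ℚ * X + A)) + -
           ((X * X - 1ℚ) * (X * X - 1ℚ)) * (A * A - ([ 2 ]ℚ * A + [ 15 ]ℚ)))
    lem₂ = solve-∀ ℚ-ring
    X²≡1 : [ 4 ]ℚ * (X * X - 1ℚ) ≡ 0ℚ → X * X ≡ 1ℚ
    X²≡1 eq′ with p*q≡0⇒p≡0∨q≡0 [ 4 ]ℚ (X * X - 1ℚ) eq′
    ... | inj₂ e = p-q≡0⇒p≡q e

  -- Quadratic points with irrational abscissa, through the residual point of a parabola.

  -- Here x² = T x - N and y = p + q x; then F_A(X²) - (p + q X)² = (X² - T X + N) (A X² + A T X + C) with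
  -- C = cofactor T N q. The parabola is h = p + q X + r (X² - T X + N), with r chosen such that h(1) = 4, and
  -- F_A(X²) - h² = (X² - T X + N) G with G = E X² + g₁ X + g₀ = E (X - 1) (X - ρ).
  cofactor : (T N q : ℚ) → ℚ
  cofactor T N q = [ 14 ]ℚ - q * q + A * (T * T) - A * N

  -- `linear` and `constant` compare the coefficients of X and of 1 in the factorisation; that of X²
  -- defines `cofactor`.
  module _ (T N p q : ℚ) (linear : A * (T * N) - T * cofactor T N q ≡ - ([ 2 ]ℚ * (p * q)))
    (constant : cofactor T N q * N ≡ B - p * p)
    (M[1]≢0 : 1ℚ - T + N ≢ 0ℚ) where
    private
      instance
        M[1]-nonZero : NonZero (1ℚ - T + N)
        M[1]-nonZero = ≢-nonZero M[1]≢0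

      r : ℚ
      r = ([ 4 ]ℚ - p - q) * 1/ (1ℚ - T + N)

      rM[1] : r * (1ℚ - T + N) ≡ [ 4 ]ℚ - p - q
      rM[1] = trans (*-assoc ([ 4 ]ℚ - p - q) _ _) (trans (cong (([ 4 ]ℚ - p - q) *_) (*-inverseˡ (1ℚ - T
          + N))) (*-identityʳ _))

      C E g₁ g₀ : ℚ
      C = cofactor T N q
      E = A - r * r
      g₁ = A * T - [ 2 ]ℚ * (r * q) + r * r * T
      g₀ = C - [ 2 ]ℚ * (r * p) - r * r * N

      E≢0 : E ≢ 0ℚ
      E≢0 E≡0 = A-nonsquare r (sym (p-q≡0⇒p≡q E≡0))

      instance
        E-nonZero : NonZero E
        E-nonZero = ≢-nonZero E≢0

      -- With M = X² - T X + N, M(1) G(1) = F_A(1) - h(1)² = 16 - 4² = 0.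
      G[1]≡0 : E + g₁ + g₀ ≡ 0ℚ
      G[1]≡0 = *-cancel-≢0 (1ℚ - T + N) M[1]≢0
        (by (kill linear 1ℚ ⊞ kill constant 1ℚ ⊞ kill rM[1] (- (r * (1ℚ - T + N) + p + q + [ 4 ]ℚ)))
            (lem A T N p q r))
        where
        lem : ∀ A T N p q r → let B = [ 2 ]ℚ - A ; C = [ 14 ]ℚ - q * q + A * (T * T) - A * N in
          (1ℚ - T + N) * (A - r * r + (A * T - [ 2 ]ℚ * (r * q) + r * r * T) + (C - [ 2 ]ℚ *
              (r * p) - r * r * N))
          ≡ 0ℚ + (1ℚ * (A * (T * N) - T * C - - ([ 2 ]ℚ * (p * q))) + 1ℚ * (C * N - (B - p * p))
                 + - (r * (1ℚ - T + N) + p + q + [ 4 ]ℚ) * (r * (1ℚ - T + N) - ([ 4 ]ℚ - p - q)))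
        lem = solve-∀ ℚ-ring

      -- The product of the roots 1 and ρ of G is g₀ / E.
      ρ : ℚ
      ρ = g₀ * 1/ E

      ρE≡g₀ : ρ * E ≡ g₀
      ρE≡g₀ = trans (*-assoc g₀ _ _) (trans (cong (g₀ *_) (*-inverseˡ E)) (*-identityʳ g₀))

      -- η is h(ρ), and F_A(ρ²) - h(ρ)² = M(ρ) G(ρ) = 0.
      fourth-point : ∀ ρ → ρ * E ≡ g₀ → let η = p + q * ρ + r * (ρ * ρ - T * ρ + N) in η * η ≡ quartic A B (ρ * ρ)
      fourth-point ρ ρE≡g₀ =
        by (kill G[1]≡0 (- (ρ * ρ - T * ρ + N) * ρ) ⊞ kill ρE≡g₀ (- (ρ * ρ - T * ρ + N) * (ρ - 1ℚ))
            ⊞ kill linear ρ ⊞ kill constant 1ℚ)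
           (lem A T N p q r ρ)
        where
        lem : ∀ A T N p q r ρ → let B = [ 2 ]ℚ - A ; C = [ 14 ]ℚ - q * q + A * (T * T) - A * N ; M = ρ * ρ - T * ρ + N ; η = p + q * ρ + r * M
                                    E = A - r * r ; g₁ = A * T - [ 2 ]ℚ * (r * q) + r * r * T ; g₀ = C - [ 2 ]ℚ * (r * p) - r * r * N in
          η * η ≡ (A * (ρ * ρ * (ρ * ρ)) + [ 14 ]ℚ * (ρ * ρ) + B)
            + (- M * ρ * (E + g₁ + g₀ - 0ℚ) + - M * (ρ - 1ℚ) * (ρ * E - g₀)
               + ρ * (A * (T * N) - T * C - - ([ 2 ]ℚ * (p * q))) + 1ℚ * (C * N - (B - p * p)))
        lem = solve-∀ ℚ-ring

      Conic : Set
      Conic = T * T ≡ A * (N * N) + [ 2 ]ℚ * N + B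

      -- Times E², the conic is homogeneous in E T, E N and E, which both cases below express as
      -- polynomials in A and r.
      conic-from-scaled : ∀ T′ N′ → E * T ≡ T′ → E * N ≡ N′ →
        T′ * T′ - A * (N′ * N′) - [ 2 ]ℚ * (E * N′) - B * (E * E) ≡ 0ℚ → Conic
      conic-from-scaled T′ N′ refl refl eq = p-q≡0⇒p≡q (*-cancel-≢0 E E≢0 (*-cancel-≢0 E E≢0 (trans
          (lem A B T N E) eq)))
        where
        lem : ∀ A B T N E → E * (E * (T * T - (A * (N * N) + [ 2 ]ℚ * N + B)))
              ≡ E * T * (E * T) - A * (E * N * (E * N)) - [ 2 ]ℚ * (E * (E * N)) - B * (E * E)
        lem = solve-∀ ℚ-ring

      -- Here h = r X² + h₁ X + h₀ has h(1) = 4 and h(-1)² = 16, so h₁ (h₀ + r) = 0. If h₁ = 0, then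
      -- h and G = E (X² - 1) are even, hence so is M and T = 0.
      chord : ρ ≡ - 1ℚ → (T ≡ 0ℚ × q ≡ 0ℚ) ⊎ Conic
      chord ρ≡-1 = cases (p*q≡0⇒p≡0∨q≡0 h₁ (h₀ + r) h₁[h₀+r]≡0)
        where
        h₁ = q - r * T
        h₀ = p + r * N
        g₀+E≡0 : g₀ + E ≡ 0ℚ
        g₀+E≡0 = by (kill ρE≡g₀ (- 1ℚ) ⊞ kill ρ≡-1 E) (lem ρ E g₀)
          where
          lem : ∀ ρ E g₀ → g₀ + E ≡ 0ℚ + (- 1ℚ * (ρ * E - g₀) + E * (ρ - - 1ℚ))
          lem = solve-∀ ℚ-ring
        g₁≡0 : g₁ ≡ 0ℚ
        g₁≡0 = by (kill G[1]≡0 1ℚ ⊞ kill g₀+E≡0 (- 1ℚ)) (lem E g₁ g₀)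
          where
          lem : ∀ E g₁ g₀ → g₁ ≡ 0ℚ + (1ℚ * (E + g₁ + g₀ - 0ℚ) + - 1ℚ * (g₀ + E - 0ℚ))
          lem = solve-∀ ℚ-ring
        h₁[h₀+r]≡0 : h₁ * (h₀ + r) ≡ 0ℚ
        h₁[h₀+r]≡0 = *-cancel-≢0 [ 2 ]ℚ (λ ()) (by (kill g₁≡0 (- (N + 1ℚ)) ⊞ kill g₀+E≡0 T
            ⊞ kill linear 1ℚ) (lem A T N p q r))
          where
          lem : ∀ A T N p q r → let C = [ 14 ]ℚ - q * q + A * (T * T) - A * N
                                    E = A - r * r ; g₁ = A * T - [ 2 ]ℚ * (r * q) + r * r * T ; g₀ = C - [ 2 ]ℚ * (r * p) - r * r * N in
            [ 2 ]ℚ * ((q - r * T) * (p + r * N + r)) ≡ 0ℚ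
              + (- (N + 1ℚ) * (g₁ - 0ℚ) + T * (g₀ + E - 0ℚ) + 1ℚ * (A * (T * N) - T * C - - ([ 2 ]ℚ * (p * q))))
          lem = solve-∀ ℚ-ring
        cases : h₁ ≡ 0ℚ ⊎ h₀ + r ≡ 0ℚ → (T ≡ 0ℚ × q ≡ 0ℚ) ⊎ Conic
        cases (inj₁ h₁≡0) = inj₁ (T≡0 , by (kill h₁≡0 1ℚ ⊞ kill T≡0 r) (lem₂ T q r))
          where
          lem₁ : ∀ A T q r → (A - r * r) * T ≡ 0ℚ + ([ 2 ]ℚ * r * (q - r * T - 0ℚ) + 1ℚ *
              (A * T - [ 2 ]ℚ * (r * q) + r * r * T - 0ℚ))
          lem₁ = solve-∀ ℚ-ring
          lem₂ : ∀ T q r → q ≡ 0ℚ + (1ℚ * (q - r * T - 0ℚ) + r * (T - 0ℚ))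
          lem₂ = solve-∀ ℚ-ring
          T≡0 : T ≡ 0ℚ
          T≡0 = *-cancel-≢0 E E≢0 (by (kill h₁≡0 ([ 2 ]ℚ * r) ⊞ kill g₁≡0 1ℚ) (lem₁ A T q r))
        -- Now h = r (X² - 1) + 4 X, and dividing F_A(X²) - h² by X² - 1 gives E X² - 8 r X + r² -
        -- B, which is E M.
        cases (inj₂ h₀+r≡0) = inj₂ (conic-from-scaled ([ 8 ]ℚ * r) (r * r - B)
          (by (kill g₁≡0 1ℚ ⊞ kill rM[1] ([ 2 ]ℚ * r) ⊞ kill h₀+r≡0 (- [ 2 ]ℚ * r)) (lem₁ A T N p q r))
          (by (kill g₀+E≡0 N ⊞ kill h₀+r≡0 (h₀ - r) ⊞ kill constant (- 1ℚ)) (lem₂ A T N p q r))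
          (by (kill A² (- [ 4 ]ℚ * (r * r))) (lem₃ A r)))
          where
          lem₁ : ∀ A T N p q r → (A - r * r) * T ≡ [ 8 ]ℚ * r
            + (1ℚ * (A * T - [ 2 ]ℚ * (r * q) + r * r * T - 0ℚ) + [ 2 ]ℚ * r * (r * (1ℚ - T + N) -
                ([ 4 ]ℚ - p - q)) + - [ 2 ]ℚ * r * (p + r * N + r - 0ℚ))
          lem₁ = solve-∀ ℚ-ring
          lem₂ : ∀ A T N p q r → let B = [ 2 ]ℚ - A ; C = [ 14 ]ℚ - q * q + A * (T * T) - A * N
                                     E = A - r * r ; g₀ = C - [ 2 ]ℚ * (r * p) - r * r * N in
            E * N ≡ r * r - B + (N * (g₀ + E - 0ℚ) + (p + r * N - r) * (p + r * N + r - 0ℚ) + - 1ℚ *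
                (C * N - (B - p * p)))
          lem₂ = solve-∀ ℚ-ring
          lem₃ : ∀ A r → let B = [ 2 ]ℚ - A ; E = A - r * r ; T′ = [ 8 ]ℚ * r ; N′ = r * r - B in
            T′ * T′ - A * (N′ * N′) - [ 2 ]ℚ * (E * N′) - B * (E * E) ≡ 0ℚ + (- [ 4 ]ℚ * (r * r) *
                (A * A - ([ 2 ]ℚ * A + [ 15 ]ℚ)))
          lem₃ = solve-∀ ℚ-ring

      tangent : ρ ≡ 1ℚ → Conic
      tangent ρ≡1 = conic-from-scaled T′ N′
        (by (kill Z≡ (¼ * r) ⊞ kill G[1]≡0 1ℚ ⊞ kill g₀-E≡0 (- 1ℚ)) (lem₁ A T N p q r))
        (by (kill A² (- ¼) ⊞ kill rM[1] (- (p + r * N + k)) ⊞ kill Z≡ (⅛ * (p + r * N + k))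
            ⊞ kill constant 1ℚ ⊞ kill g₀-E≡0 (- N)) (lem₂ A T N p q r))
        (by (kill A² ([ 2 ]ℚ * (A * r) - A * (r * r) - [ 3 ]ℚ * (r * r) + [ 2 ]ℚ * (r * (r * r)))) (lem₃ A r))
        where
        ¼ ⅛ k T′ N′ : ℚ
        ¼ = + 1 / 4
        ⅛ = + 1 / 8
        -- By tangency h = 4 + ½ (A + 7)(X - 1) + r (X - 1)². Its value at 0 is k, and dividing
        -- F_A(X²) - h² by (X - 1)² gives E M = E X² - T′ X + N′.
        k = ½ * (1ℚ - A) + r
        T′ = A * r + [ 7 ]ℚ * r - [ 2 ]ℚ * (r * r) - [ 2 ]ℚ * A
        N′ = A * r - A - r - r * r - [ 2 ]ℚ
        g₀-E≡0 : g₀ - E ≡ 0ℚ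
        g₀-E≡0 = by (kill ρE≡g₀ (- 1ℚ) ⊞ kill ρ≡1 E) (lem ρ E g₀)
          where
          lem : ∀ ρ E g₀ → g₀ - E ≡ 0ℚ + (- 1ℚ * (ρ * E - g₀) + E * (ρ - 1ℚ))
          lem = solve-∀ ℚ-ring
        -- Both F_A(X²) and h² have the same derivative at the double root 1.
        Z≡ : [ 8 ]ℚ * (q + r * ([ 2 ]ℚ - T)) ≡ [ 4 ]ℚ * A + [ 28 ]ℚ
        Z≡ = by (kill G[1]≡0 (- ([ 2 ]ℚ - T) - (1ℚ - T + N)) ⊞ kill g₀-E≡0 (1ℚ - T + N)
            ⊞ kill rM[1] (- [ 2 ]ℚ * (q + r * ([ 2 ]ℚ - T))) ⊞ kill linear 1ℚ)
          (lem A T N p q r)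
          where
          lem : ∀ A T N p q r → let C = [ 14 ]ℚ - q * q + A * (T * T) - A * N
                                    E = A - r * r ; g₁ = A * T - [ 2 ]ℚ * (r * q) + r * r * T ; g₀ = C - [ 2 ]ℚ * (r * p) - r * r * N in
            [ 8 ]ℚ * (q + r * ([ 2 ]ℚ - T)) ≡ [ 4 ]ℚ * A + [ 28 ]ℚ
            + ((- ([ 2 ]ℚ - T) - (1ℚ - T + N)) * (E + g₁ + g₀ - 0ℚ) + (1ℚ - T + N) * (g₀ - E - 0ℚ)
              + - [ 2 ]ℚ * (q + r * ([ 2 ]ℚ - T)) * (r * (1ℚ - T + N) - ([ 4 ]ℚ - p - q)) + 1ℚ * (A *
                  (T * N) - T * C - - ([ 2 ]ℚ * (p * q))))
          lem = solve-∀ ℚ-ring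
        lem₁ : ∀ A T N p q r → let C = [ 14 ]ℚ - q * q + A * (T * T) - A * N
                                   E = A - r * r ; g₁ = A * T - [ 2 ]ℚ * (r * q) + r * r * T ; g₀ = C - [ 2 ]ℚ * (r * p) - r * r * N in
          E * T ≡ A * r + [ 7 ]ℚ * r - [ 2 ]ℚ * (r * r) - [ 2 ]ℚ * A
            + ((+ 1 / 4) * r * ([ 8 ]ℚ * (q + r * ([ 2 ]ℚ - T)) - ([ 4 ]ℚ * A + [ 28 ]ℚ)) + 1ℚ * (E + g₁
                + g₀ - 0ℚ) + - 1ℚ * (g₀ - E - 0ℚ))
        lem₁ = solve-∀ ℚ-ring
        lem₂ : ∀ A T N p q r → let B = [ 2 ]ℚ - A ; C = [ 14 ]ℚ - q * q + A * (T * T) - A * N ; k = ½ * (1ℚ - A) + r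
                                   E = A - r * r ; g₀ = C - [ 2 ]ℚ * (r * p) - r * r * N in
          E * N ≡ A * r - A - r - r * r - [ 2 ]ℚ
            + (- (+ 1 / 4) * (A * A - ([ 2 ]ℚ * A + [ 15 ]ℚ)) + - (p + r * N + k) * (r * (1ℚ - T + N) -
                ([ 4 ]ℚ - p - q))
              + (+ 1 / 8) * (p + r * N + k) * ([ 8 ]ℚ * (q + r * ([ 2 ]ℚ - T)) - ([ 4 ]ℚ * A + [ 28 ]ℚ))
              + 1ℚ * (C * N - (B - p * p)) + - N * (g₀ - E - 0ℚ))
        lem₂ = solve-∀ ℚ-ring
        lem₃ : ∀ A r → let B = [ 2 ]ℚ - A ; E = A - r * r
                           T′ = A * r + [ 7 ]ℚ * r - [ 2 ]ℚ * (r * r) - [ 2 ]ℚ * A ; N′ = A * r - A - r - r * r - [ 2 ]ℚ in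
          T′ * T′ - A * (N′ * N′) - [ 2 ]ℚ * (E * N′) - B * (E * E) ≡ 0ℚ
            + (([ 2 ]ℚ * (A * r) - A * (r * r) - [ 3 ]ℚ * (r * r) + [ 2 ]ℚ * (r * (r * r))) * (A * A -
                ([ 2 ]ℚ * A + [ 15 ]ℚ)))
        lem₃ = solve-∀ ℚ-ring

    quadratic-points : (T ≡ 0ℚ × q ≡ 0ℚ) ⊎ Conic
    quadratic-points = [ inj₂ ∘ tangent ∘ p-q≡0⇒p≡q , chord ∘ p-q≡0⇒p≡q ]′
      (p*q≡0⇒p≡0∨q≡0 (ρ - 1ℚ) (ρ - - 1ℚ) (by (kill (rational-points ρ (p + q * ρ + r * (ρ * ρ - T * ρ
          + N)) (fourth-point ρ ρE≡g₀)) 1ℚ) (lem ρ)))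
      where
      lem : ∀ ρ → (ρ - 1ℚ) * (ρ - - 1ℚ) ≡ 0ℚ + 1ℚ * (ρ * ρ - 1ℚ)
      lem = solve-∀ ℚ-ring


  -- Points with abscissa a + b√d in coordinates.

  -- At a = 0 the conic becomes A D² - 2 D + B = (D - 1)(A D - B) = 0.
  conic-at-0 : ∀ a D → let T = [ 2 ]ℚ * a ; N = a * a - D in
    a ≡ 0ℚ → D ≢ 1ℚ → T * T ≡ A * (N * N) + [ 2 ]ℚ * N + B → A * D ≡ B
  conic-at-0 a D a≡0 D≢1 eq = p-q≡0⇒p≡q (*-cancel-≢0 (D - 1ℚ) (D≢1 ∘ p-q≡0⇒p≡q)
    (by (kill eq (- 1ℚ) ⊞ kill a≡0 ([ 2 ]ℚ * a - A * (a * (a * a) - [ 2 ]ℚ * (a * D)))) (lem A a D)))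
    where
    lem : ∀ A a D → let B = [ 2 ]ℚ - A ; T = [ 2 ]ℚ * a ; N = a * a - D in (D - 1ℚ) * (A * D - B) ≡ 0ℚ
      + (- 1ℚ * (T * T - (A * (N * N) + [ 2 ]ℚ * N + B)) + ([ 2 ]ℚ * a - A * (a * (a * a) - [ 2 ]ℚ *
          (a * D))) * (a - 0ℚ))
    lem = solve-∀ ℚ-ring

  -- Multiplying by A² gives (A w)² = A³ + B³ + 14 A B = -112.
  AD≡B⇒⊥ : ∀ D w → A * D ≡ B → w * w ≢ quartic B A D
  AD≡B⇒⊥ D w AD≡B eq = square≢neg (A * w) (- [ 112 ]ℚ)
    (by (kill eq (A * A) ⊞ kill AD≡B (B * (A * D + B) + [ 14 ]ℚ * A) ⊞ kill A² (- [ 8 ]ℚ)) (lem A D w))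
    where
    lem : ∀ A D w → let B = [ 2 ]ℚ - A in A * w * (A * w) ≡ - [ 112 ]ℚ
      + (A * A * (w * w - (B * (D * D) + [ 14 ]ℚ * D + A)) + (B * (A * D + B) + [ 14 ]ℚ * A) *
          (A * D - B) + - [ 8 ]ℚ * (A * A - ([ 2 ]ℚ * A + [ 15 ]ℚ)))
    lem = solve-∀ ℚ-ring

  module _ (1+A-nonsquare : NonSquare (½ * (1ℚ + A))) (1+B-nonsquare : NonSquare (½ * (1ℚ + B))) where

    -- At the roots 1 / A and B of F_A, the values of F_B are (8 / A)² ½ (1 + A) and 8² ½ (1 + B),
    -- neither of them a square.
    quartic≡0⇒⊥ : ∀ D w → quartic A B D ≡ 0ℚ → w * w ≢ quartic B A D
    quartic≡0⇒⊥ D w eq₀ eq = [ AD≢1 , D≢B ]′ (quartic≡0 eq₀)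
      where
      ⅛ 1/64 : ℚ
      ⅛ = + 1 / 8
      1/64 = + 1 / 64
      AD≢1 : A * D ≢ 1ℚ
      AD≢1 AD≡1 = 1+A-nonsquare (⅛ * A * w)
        (by (kill eq (1/64 * (A * A)) ⊞ kill AD≡1 (1/64 * (B * (A * D + 1ℚ) + [ 14 ]ℚ * A))
            ⊞ kill A² (1/64 * (A + [ 2 ]ℚ))) (lem A D w))
        where
        lem : ∀ A D w → let B = [ 2 ]ℚ - A ; ⅛ = + 1 / 8 ; 1/64 = + 1 / 64 in ⅛ * A * w * (⅛ * A * w) ≡ ½ * (1ℚ + A)
          + (1/64 * (A * A) * (w * w - (B * (D * D) + [ 14 ]ℚ * D + A)) + 1/64 * (B * (A * D + 1ℚ)
              + [ 14 ]ℚ * A) * (A * D - 1ℚ)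
             + 1/64 * (A + [ 2 ]ℚ) * (A * A - ([ 2 ]ℚ * A + [ 15 ]ℚ)))
        lem = solve-∀ ℚ-ring
      D≢B : D ≢ B
      D≢B D≡B = 1+B-nonsquare (⅛ * w) (by (kill (trans eq (cong (quartic B A) D≡B)) 1/64
          ⊞ kill A² (1/64 * ([ 4 ]ℚ - A))) (lem A w))
        where
        lem : ∀ A w → let B = [ 2 ]ℚ - A ; ⅛ = + 1 / 8 ; 1/64 = + 1 / 64 in ⅛ * w * (⅛ * w) ≡ ½ * (1ℚ + B)
          + (1/64 * (w * w - (B * (B * B) + [ 14 ]ℚ * B + A)) + 1/64 * ([ 4 ]ℚ - A) * (A * A -
              ([ 2 ]ℚ * A + [ 15 ]ℚ)))
        lem = solve-∀ ℚ-ring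

  module _ {d a b y₀ y₁ : ℚ} (d-nonsquare : NonSquare d) (b≢0 : b ≢ 0ℚ) (lies : Lies-on A B d a b y₀ y₁) where
    private
      -- T and N are the trace and norm of x = a + b√d; below, p and q are chosen so that y = p + q
      -- x.
      D T N : ℚ
      D = d * (b * b)
      T = [ 2 ]ℚ * a
      N = a * a - D

      instance
        b-nonZero : NonZero b
        b-nonZero = ≢-nonZero b≢0

      i q p s : ℚ
      i = 1/ b
      q = y₁ * i
      p = y₀ - q * a
      s = a * a + D

      ib≡1 : i * b ≡ 1ℚ
      ib≡1 = *-inverseˡ b

      qb≡y₁ : q * b ≡ y₁
      qb≡y₁ = trans (*-assoc y₁ i b) (trans (cong (y₁ *_) ib≡1) (*-identityʳ y₁))

      real : y₀ * y₀ + q * q * D ≡ A * (s * s + [ 4 ]ℚ * (a * a * D)) + [ 14 ]ℚ * s + B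
      real = trans (trans (lem d b q y₀) (cong (λ y₁ → y₀ * y₀ + d * (y₁ * y₁)) qb≡y₁)) (proj₁ lies)
        where
        lem : ∀ d b q y₀ → y₀ * y₀ + q * q * (d * (b * b)) ≡ y₀ * y₀ + d * (q * b * (q * b))
        lem = solve-∀ ℚ-ring

      imaginary : y₀ * q ≡ [ 2 ]ℚ * (A * (a * s)) + [ 14 ]ℚ * a
      imaginary = by (kill (proj₂ lies) i ⊞ kill ib≡1 ([ 2 ]ℚ * (A * (a * s)) + [ 14 ]ℚ * a))
          (lem y₀ y₁ i b ([ 2 ]ℚ * (A * (a * s)) + [ 14 ]ℚ * a))
        where
        lem : ∀ y₀ y₁ i b R → y₀ * (y₁ * i) ≡ R + (i * (y₀ * y₁ - b * R) + R * (i * b - 1ℚ))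
        lem = solve-∀ ℚ-ring

      -- M(1) = (1 - a)² - d b² vanishes only if d is the square of (1 - a) / b.
      M[1]≢0 : 1ℚ - T + N ≢ 0ℚ
      M[1]≢0 eq = d-nonsquare ((1ℚ - a) * i) (by (kill eq (i * i) ⊞ kill ib≡1 (d * (i * b + 1ℚ))) (lem a d b i))
        where
        lem : ∀ a d b i → (1ℚ - a) * i * ((1ℚ - a) * i) ≡ d
          + (i * i * (1ℚ - [ 2 ]ℚ * a + (a * a - d * (b * b)) - 0ℚ) + d * (i * b + 1ℚ) * (i * b - 1ℚ))
        lem = solve-∀ ℚ-ring

    irrational-abscissa : (a ≡ 0ℚ × y₁ ≡ 0ℚ) ⊎ T * T ≡ A * (N * N) + [ 2 ]ℚ * N + B
    irrational-abscissa = Sum.map₁ (λ (T≡0 , q≡0) → *-cancel-≢0 [ 2 ]ℚ (λ ()) T≡0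
        , trans (sym qb≡y₁) (trans (cong (_* b) q≡0) (*-zeroˡ b)))
      (quadratic-points T N p q (by (kill imaginary [ 2 ]ℚ) (lem₁ A a D y₀ q))
        (by (kill real 1ℚ ⊞ kill imaginary (- ([ 2 ]ℚ * a))) (lem₂ A a D y₀ q)) M[1]≢0)
      where
      lem₁ : ∀ A a D y₀ q → let T = [ 2 ]ℚ * a ; N = a * a - D ; s = a * a + D ; p = y₀ - q * a ; C = [ 14 ]ℚ - q * q + A * (T * T) - A * N in
        A * (T * N) - T * C ≡ - ([ 2 ]ℚ * (p * q)) + [ 2 ]ℚ * (y₀ * q - ([ 2 ]ℚ * (A * (a * s)) + [ 14 ]ℚ * a))
      lem₁ = solve-∀ ℚ-ring
      lem₂ : ∀ A a D y₀ q → let B = [ 2 ]ℚ - A ; T = [ 2 ]ℚ * a ; N = a * a - D ; s = a * a + D ; p = y₀ - q * a ; C = [ 14 ]ℚ - q * q + A * (T * T) - A * N in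
        C * N ≡ B - p * p + (1ℚ * (y₀ * y₀ + q * q * D - (A * (s * s + [ 4 ]ℚ * (a * a * D)) + [ 14 ]ℚ * s + B))
          + - ([ 2 ]ℚ * a) * (y₀ * q - ([ 2 ]ℚ * (A * (a * s)) + [ 14 ]ℚ * a)))
      lem₂ = solve-∀ ℚ-ring

  rational-ordinate : ∀ {d a b y₀ y₁} → a ≡ 0ℚ → y₁ ≡ 0ℚ → Lies-on A B d a b y₀ y₁ → y₀ * y₀
      ≡ quartic A B (d * (b * b))
  rational-ordinate {d} {a} {b} {y₀} {y₁} a≡0 y₁≡0 (lies , _) =
    by (kill lies 1ℚ ⊞ kill a≡0 (A * (a * (a * a) + [ 6 ]ℚ * (a * D)) + [ 14 ]ℚ * a)
        ⊞ kill y₁≡0 (- (d * y₁))) (lem A d a D y₀ y₁)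
    where
    D = d * (b * b)
    lem : ∀ A d a D y₀ y₁ → let B = [ 2 ]ℚ - A ; s = a * a + D in
      y₀ * y₀ ≡ A * (D * D) + [ 14 ]ℚ * D + B
        + (1ℚ * (y₀ * y₀ + d * (y₁ * y₁) - (A * (s * s + [ 4 ]ℚ * (a * a * D)) + [ 14 ]ℚ * s + B))
           + (A * (a * (a * a) + [ 6 ]ℚ * (a * D)) + [ 14 ]ℚ * a) * (a - 0ℚ) + - (d * y₁) * (y₁ - 0ℚ))
    lem = solve-∀ ℚ-ring

  rational-abscissa : ∀ {d a b y₀ y₁} → b ≡ 0ℚ → Lies-on A B d a b y₀ y₁ →
    y₀ * y₀ + d * (y₁ * y₁) ≡ quartic A B (a * a) × y₀ * y₁ ≡ 0ℚ
  rational-abscissa {d} {a} {b} {y₀} {y₁} b≡0 (lies , lies′) =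
      by (kill lies 1ℚ ⊞ kill b≡0 (A * ([ 6 ]ℚ * (a * a) + d * (b * b)) * (d * b) + [ 14 ]ℚ * (d * b)))
          (lem₁ A d a b y₀ y₁)
    , by (kill lies′ 1ℚ ⊞ kill b≡0 R) (lem₂ b y₀ y₁ R)
    where
    R = [ 2 ]ℚ * (A * (a * (a * a + d * (b * b)))) + [ 14 ]ℚ * a
    lem₁ : ∀ A d a b y₀ y₁ → let B = [ 2 ]ℚ - A ; D = d * (b * b) ; s = a * a + D in
      y₀ * y₀ + d * (y₁ * y₁) ≡ A * (a * a * (a * a)) + [ 14 ]ℚ * (a * a) + B
        + (1ℚ * (y₀ * y₀ + d * (y₁ * y₁) - (A * (s * s + [ 4 ]ℚ * (a * a * D)) + [ 14 ]ℚ * s + B))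
           + (A * ([ 6 ]ℚ * (a * a) + d * (b * b)) * (d * b) + [ 14 ]ℚ * (d * b)) * (b - 0ℚ))
    lem₁ = solve-∀ ℚ-ring
    lem₂ : ∀ b y₀ y₁ R → y₀ * y₁ ≡ 0ℚ + (1ℚ * (y₀ * y₁ - b * R) + R * (b - 0ℚ))
    lem₂ = solve-∀ ℚ-ring

-- Combining A = 5 and A = -3 on the curve Y.

p²≡1⇒p≡±1 : ∀ p → p * p ≡ 1ℚ → p ≡ 1ℚ ⊎ p ≡ - 1ℚ
p²≡1⇒p≡±1 p p²≡1 = Sum.map p-q≡0⇒p≡q p-q≡0⇒p≡q
  (p*q≡0⇒p≡0∨q≡0 (p - 1ℚ) (p - - 1ℚ) (by (kill p²≡1 1ℚ) (lem p)))
  where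
  lem : ∀ p → (p - 1ℚ) * (p - - 1ℚ) ≡ 0ℚ + 1ℚ * (p * p - 1ℚ)
  lem = solve-∀ ℚ-ring

square⇒IsPM : ∀ p n → p * p ≡ [ n ]ℚ * [ n ]ℚ → IsPM p n
square⇒IsPM p n eq = Sum.map p-q≡0⇒p≡q p-q≡0⇒p≡q
  (p*q≡0⇒p≡0∨q≡0 (p - [ n ]ℚ) (p - - [ n ]ℚ) (by (kill eq 1ℚ) (lem p [ n ]ℚ)))
  where
  lem : ∀ p n → (p - n) * (p - - n) ≡ 0ℚ + 1ℚ * (p * p - n * n)
  lem = solve-∀ ℚ-ring

IsPM⇒square : ∀ p n → IsPM p n → p * p ≡ [ n ]ℚ * [ n ]ℚ
IsPM⇒square p n (inj₁ p≡n) = cong₂ _*_ p≡n p≡n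
IsPM⇒square p n (inj₂ p≡-n) = trans (cong₂ _*_ p≡-n p≡-n) (lem [ n ]ℚ)
  where
  lem : ∀ n → - n * - n ≡ n * n
  lem = solve-∀ ℚ-ring

3-nonsquare : NonSquare [ 3 ]ℚ
3-nonsquare = between-squares 1 3 (ℕ.s≤s (ℕ.s≤s ℕ.z≤n)) (from-yes (4 ℕ.≤? 4))

5-nonsquare : NonSquare [ 5 ]ℚ
5-nonsquare = between-squares 2 5 (from-yes (5 ℕ.≤? 5)) (from-yes (6 ℕ.≤? 9))

-1-nonsquare : NonSquare (- 1ℚ)
-1-nonsquare s = square≢neg s (- 1ℚ)

-3-nonsquare : NonSquare (- [ 3 ]ℚ)
-3-nonsquare s = square≢neg s (- [ 3 ]ℚ)

module Quartic₊ = Quartic [ 5 ]ℚ refl 5-nonsquare -3-nonsquare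
module Quartic₋ = Quartic (- [ 3 ]ℚ) refl -3-nonsquare 5-nonsquare

module _ {d a b y₀ y₁ z₀ z₁ : ℚ} (d-nonsquare : NonSquare d)
  (y-lies : Lies-on [ 5 ]ℚ (- [ 3 ]ℚ) d a b y₀ y₁) (z-lies : Lies-on (- [ 3 ]ℚ) [ 5 ]ℚ d a b z₀ z₁) where

  d≢0 : d ≢ 0ℚ
  d≢0 d≡0 = d-nonsquare 0ℚ (sym d≡0)

  module _ (b≢0 : b ≢ 0ℚ) where
    D T N : ℚ
    D = d * (b * b)
    T = [ 2 ]ℚ * a
    N = a * a - D

    Conic : ℚ → ℚ → Set
    Conic A B = T * T ≡ A * (N * N) + [ 2 ]ℚ * N + B

    D≢0 : D ≢ 0ℚ
    D≢0 D≡0 = b≢0 (*-cancel-≢0 b b≢0 (*-cancel-≢0 d d≢0 D≡0))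

    D≢1 : D ≢ 1ℚ
    D≢1 D≡1 = d-nonsquare i (by (kill D≡1 (- (i * i)) ⊞ kill (*-inverseˡ b) (d * (i * b + 1ℚ))) (lem d b i))
      where
      instance
        _ = ≢-nonZero b≢0
      i = 1/ b
      lem : ∀ d b i → i * i ≡ d + (- (i * i) * (d * (b * b) - 1ℚ) + d * (i * b + 1ℚ) * (i * b - 1ℚ))
      lem = solve-∀ ℚ-ring

    -- The conics differ by 8 (N² - 1). For N = 1 they give a² = 1 and D = 0; for N = -1 they give a
    -- = 0 and D = 1.
    both-conics : Conic [ 5 ]ℚ (- [ 3 ]ℚ) → Conic (- [ 3 ]ℚ) [ 5 ]ℚ → ⊥
    both-conics c₊ c₋ = [ (λ N≡1 → D≢0 (by (kill c₊ ¼ ⊞ kill N≡1 (¼ * ([ 5 ]ℚ * N + [ 3 ]ℚ))) (lem₂ a D)))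
                        , (λ N≡-1 → D≢1 (by (kill c₊ ¼ ⊞ kill N≡-1 (¼ * ([ 5 ]ℚ * N - [ 7 ]ℚ))) (lem₃ a D))) ]′
      (p²≡1⇒p≡±1 N (by (kill c₊ (- ⅛) ⊞ kill c₋ ⅛) (lem₁ T N)))
      where
      ¼ ⅛ : ℚ
      ¼ = + 1 / 4
      ⅛ = + 1 / 8
      lem₁ : ∀ T N → N * N ≡ 1ℚ
        + (- (+ 1 / 8) * (T * T - ([ 5 ]ℚ * (N * N) + [ 2 ]ℚ * N + - [ 3 ]ℚ)) + (+ 1 / 8) * (T * T -
            (- [ 3 ]ℚ * (N * N) + [ 2 ]ℚ * N + [ 5 ]ℚ)))
      lem₁ = solve-∀ ℚ-ring
      lem₂ : ∀ a D → let T = [ 2 ]ℚ * a ; N = a * a - D in D ≡ 0ℚ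
        + ((+ 1 / 4) * (T * T - ([ 5 ]ℚ * (N * N) + [ 2 ]ℚ * N + - [ 3 ]ℚ)) + (+ 1 / 4) * ([ 5 ]ℚ * N
            + [ 3 ]ℚ) * (N - 1ℚ))
      lem₂ = solve-∀ ℚ-ring
      lem₃ : ∀ a D → let T = [ 2 ]ℚ * a ; N = a * a - D in D ≡ 1ℚ
        + ((+ 1 / 4) * (T * T - ([ 5 ]ℚ * (N * N) + [ 2 ]ℚ * N + - [ 3 ]ℚ)) + (+ 1 / 4) *
            ([ 5 ]ℚ * N - [ 7 ]ℚ) * (N - - 1ℚ))
      lem₃ = solve-∀ ℚ-ring

    -- Here x² = D is rational and (y₀ z₀)² is the product of both quartics at D, so y₀ z₀ = 0 or D
    -- = ±1. At D = -1 one has y₀² = -12.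
    both-rational : a ≡ 0ℚ → y₁ ≡ 0ℚ → z₁ ≡ 0ℚ → ⊥
    both-rational a≡0 y₁≡0 z₁≡0 = [ y₀z₀≢0 , ([ D≢1 , D≢-1 ]′ ∘ p²≡1⇒p≡±1 D) ]′
        (Quartic₊.product-rational-points D (y₀ * z₀) (trans (lem y₀ z₀) (cong₂ _*_ y₀² z₀²)))
      where
      y₀² : y₀ * y₀ ≡ quartic [ 5 ]ℚ (- [ 3 ]ℚ) D
      y₀² = Quartic₊.rational-ordinate {d} {a} {b} {y₀} {y₁} a≡0 y₁≡0 y-lies
      z₀² : z₀ * z₀ ≡ quartic (- [ 3 ]ℚ) [ 5 ]ℚ D
      z₀² = Quartic₋.rational-ordinate {d} {a} {b} {z₀} {z₁} a≡0 z₁≡0 z-lies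
      lem : ∀ y z → y * z * (y * z) ≡ y * y * (z * z)
      lem = solve-∀ ℚ-ring
      y₀z₀≢0 : y₀ * z₀ ≢ 0ℚ
      y₀z₀≢0 eq = [ (λ y₀≡0 → Quartic₊.quartic≡0⇒⊥ 3-nonsquare -1-nonsquare D z₀ (trans (sym y₀²) (cong
          (λ y → y * y) y₀≡0)) z₀²)
                  , (λ z₀≡0 → Quartic₋.quartic≡0⇒⊥ -1-nonsquare 3-nonsquare D y₀ (trans (sym z₀²) (cong
                      (λ z → z * z) z₀≡0)) y₀²) ]′
        (p*q≡0⇒p≡0∨q≡0 y₀ z₀ eq)
      D≢-1 : D ≢ - 1ℚ
      D≢-1 D≡-1 = square≢neg y₀ (- [ 12 ]ℚ) (trans y₀² (cong (quartic [ 5 ]ℚ (- [ 3 ]ℚ)) D≡-1))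

    irrational-abscissa⇒⊥ : ⊥
    irrational-abscissa⇒⊥ = combine
      (Quartic₊.irrational-abscissa {d} {a} {b} {y₀} {y₁} d-nonsquare b≢0 y-lies)
      (Quartic₋.irrational-abscissa {d} {a} {b} {z₀} {z₁} d-nonsquare b≢0 z-lies)
      where
      combine : (a ≡ 0ℚ × y₁ ≡ 0ℚ) ⊎ Conic [ 5 ]ℚ (- [ 3 ]ℚ) → (a ≡ 0ℚ × z₁ ≡ 0ℚ) ⊎ Conic (- [ 3 ]ℚ) [ 5 ]ℚ → ⊥
      combine (inj₁ (a≡0 , y₁≡0)) (inj₁ (_ , z₁≡0)) = both-rational a≡0 y₁≡0 z₁≡0
      combine (inj₁ (a≡0 , y₁≡0)) (inj₂ c) = Quartic₋.AD≡B⇒⊥ D y₀ (Quartic₋.conic-at-0 a D a≡0 D≢1 c)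
        (Quartic₊.rational-ordinate {d} {a} {b} {y₀} {y₁} a≡0 y₁≡0 y-lies)
      combine (inj₂ c) (inj₁ (a≡0 , z₁≡0)) = Quartic₊.AD≡B⇒⊥ D z₀ (Quartic₊.conic-at-0 a D a≡0 D≢1 c)
        (Quartic₋.rational-ordinate {d} {a} {b} {z₀} {z₁} a≡0 z₁≡0 z-lies)
      combine (inj₂ c₊) (inj₂ c₋) = both-conics c₊ c₋

  module _ (b≡0 : b ≡ 0ℚ) where
    X : ℚ
    X = a * a

    y-norm : y₀ * y₀ + d * (y₁ * y₁) ≡ quartic [ 5 ]ℚ (- [ 3 ]ℚ) X
    y-norm = proj₁ (Quartic₊.rational-abscissa {d} {a} {b} {y₀} {y₁} b≡0 y-lies)
    y₀y₁≡0 : y₀ * y₁ ≡ 0ℚ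
    y₀y₁≡0 = proj₂ (Quartic₊.rational-abscissa {d} {a} {b} {y₀} {y₁} b≡0 y-lies)
    z-norm : z₀ * z₀ + d * (z₁ * z₁) ≡ quartic (- [ 3 ]ℚ) [ 5 ]ℚ X
    z-norm = proj₁ (Quartic₋.rational-abscissa {d} {a} {b} {z₀} {z₁} b≡0 z-lies)
    z₀z₁≡0 : z₀ * z₁ ≡ 0ℚ
    z₀z₁≡0 = proj₂ (Quartic₋.rational-abscissa {d} {a} {b} {z₀} {z₁} b≡0 z-lies)

    rational-part : ∀ u v {F} → v ≡ 0ℚ → u * u + d * (v * v) ≡ F → u * u ≡ F
    rational-part u v {F} v≡0 eq = by (kill eq 1ℚ ⊞ kill v≡0 (- (d * v))) (lem d u v F)
      where
      lem : ∀ d u v F → u * u ≡ F + (1ℚ * (u * u + d * (v * v) - F) + - (d * v) * (v - 0ℚ))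
      lem = solve-∀ ℚ-ring

    irrational-part : ∀ u v {F} → u ≡ 0ℚ → u * u + d * (v * v) ≡ F → d * (v * v) ≡ F
    irrational-part u v {F} u≡0 eq = by (kill eq 1ℚ ⊞ kill u≡0 (- u)) (lem d u v F)
      where
      lem : ∀ d u v F → d * (v * v) ≡ F + (1ℚ * (u * u + d * (v * v) - F) + - u * (u - 0ℚ))
      lem = solve-∀ ℚ-ring

    X≡1 : X ≡ 1ℚ
    X≡1 = [ (λ y₀≡0 → [ (λ z₀≡0 → both-irrational y₀≡0 z₀≡0) , from-z ]′
        (p*q≡0⇒p≡0∨q≡0 z₀ z₁ z₀z₁≡0)) , from-y ]′
        (p*q≡0⇒p≡0∨q≡0 y₀ y₁ y₀y₁≡0)
      where
      from-y : y₁ ≡ 0ℚ → X ≡ 1ℚ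
      from-y y₁≡0 = Quartic₊.rational-points a y₀ (rational-part y₀ y₁ y₁≡0 y-norm)
      from-z : z₁ ≡ 0ℚ → X ≡ 1ℚ
      from-z z₁≡0 = Quartic₋.rational-points a z₀ (rational-part z₀ z₁ z₁≡0 z-norm)
      -- Both y and z are rational multiples of √d, so y z = d y₁ z₁ is rational.
      both-irrational : y₀ ≡ 0ℚ → z₀ ≡ 0ℚ → X ≡ 1ℚ
      both-irrational y₀≡0 z₀≡0 = [ (λ w≡0 → [ from-y , from-z ]′ (p*q≡0⇒p≡0∨q≡0 y₁ z₁ (*-cancel-≢0 d d≢0 w≡0)))
                                  , ([ id , (λ X≡-1 → ⊥-elim (square≢neg a (- 1ℚ) X≡-1)) ]′ ∘ p²≡1⇒p≡±1 X) ]′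
        (Quartic₊.product-rational-points X (d * (y₁ * z₁)) (trans (lem d y₁ z₁)
          (cong₂ _*_ (irrational-part y₀ y₁ y₀≡0 y-norm) (irrational-part z₀ z₁ z₀≡0 z-norm))))
        where
        lem : ∀ d y z → d * (y * z) * (d * (y * z)) ≡ d * (y * y) * (d * (z * z))
        lem = solve-∀ ℚ-ring

    -- If v ≠ 0 then u = 0 and d = (4 / v)² would be a square.
    ordinate : ∀ {u v} → u * u + d * (v * v) ≡ [ 16 ]ℚ → u * v ≡ 0ℚ → v ≡ 0ℚ × IsPM u 4
    ordinate {u} {v} eq uv≡0 = decide (v ≟ 0ℚ)
      where
      decide : Dec (v ≡ 0ℚ) → v ≡ 0ℚ × IsPM u 4
      decide (yes v≡0) = v≡0 , square⇒IsPM u 4 (rational-part u v v≡0 eq)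
      decide (no v≢0) = ⊥-elim (d-nonsquare ([ 4 ]ℚ * i) (by (kill dv² (- (i * i))
          ⊞ kill (*-inverseˡ v) (d * (i * v + 1ℚ))) (lem d v i)))
        where
        instance
          _ = ≢-nonZero v≢0
        i = 1/ v
        u≡0 : u ≡ 0ℚ
        u≡0 = *-cancel-≢0 v v≢0 (trans (*-comm v u) uv≡0)
        dv² : d * (v * v) ≡ [ 16 ]ℚ
        dv² = irrational-part u v u≡0 eq
        lem : ∀ d v i → [ 4 ]ℚ * i * ([ 4 ]ℚ * i) ≡ d + (- (i * i) * (d * (v * v) - [ 16 ]ℚ) + d * (i * v
            + 1ℚ) * (i * v - 1ℚ))
        lem = solve-∀ ℚ-ring

    listed : IsListedPoint d (a + b √) (y₀ + y₁ √) (z₀ + z₁ √)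
    listed = b≡0 , proj₁ y , proj₁ z , square⇒IsPM a 1 X≡1 , proj₂ y , proj₂ z
      where
      y = ordinate (trans y-norm (cong (quartic [ 5 ]ℚ (- [ 3 ]ℚ)) X≡1)) y₀y₁≡0
      z = ordinate (trans z-norm (cong (quartic (- [ 3 ]ℚ) [ 5 ]ℚ) X≡1)) z₀z₁≡0

-- Translation between `OnY` and equations in the coordinates.

module _ {d : ℚ} where

  y²-re : ∀ a b → let x = a + b √ ; D = d * (b * b) ; s = a * a + D in
    re {d} ((ι [ 5 ]ℚ ⊗ x ⊗ x ⊖ ι 1ℚ) ⊗ (x ⊗ x ⊕ ι [ 3 ]ℚ)) ≡ [ 5 ]ℚ * (s * s + [ 4 ]ℚ * (a * a * D))
        + [ 14 ]ℚ * s + - [ 3 ]ℚ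
  y²-re a b = lem d a b
    where
    -- The components u of 5 x, v of 5 x² - 1 and w of x² + 3 are spelled exactly as the operations
    -- of `Q√ d` compute them, so the identity matches definitionally.
    lem : ∀ d a b → let u₀ = [ 5 ]ℚ * a + d * (0ℚ * b) ; u₁ = [ 5 ]ℚ * b + 0ℚ * a
                        v₀ = u₀ * a + d * (u₁ * b) + - 1ℚ ; v₁ = u₀ * b + u₁ * a + - 0ℚ
                        w₀ = a * a + d * (b * b) + [ 3 ]ℚ ; w₁ = a * b + b * a + 0ℚ ; D = d * (b * b) ; s = a * a + D in
      v₀ * w₀ + d * (v₁ * w₁) ≡ [ 5 ]ℚ * (s * s + [ 4 ]ℚ * (a * a * D)) + [ 14 ]ℚ * s + - [ 3 ]ℚ
    lem = solve-∀ ℚ-ring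

  y²-im : ∀ a b → let x = a + b √ ; D = d * (b * b) ; s = a * a + D in
    im {d} ((ι [ 5 ]ℚ ⊗ x ⊗ x ⊖ ι 1ℚ) ⊗ (x ⊗ x ⊕ ι [ 3 ]ℚ)) ≡ [ 2 ]ℚ * (b * ([ 2 ]ℚ * ([ 5 ]ℚ * (a * s))
        + [ 14 ]ℚ * a))
  y²-im a b = lem d a b
    where
    lem : ∀ d a b → let u₀ = [ 5 ]ℚ * a + d * (0ℚ * b) ; u₁ = [ 5 ]ℚ * b + 0ℚ * a
                        v₀ = u₀ * a + d * (u₁ * b) + - 1ℚ ; v₁ = u₀ * b + u₁ * a + - 0ℚ
                        w₀ = a * a + d * (b * b) + [ 3 ]ℚ ; w₁ = a * b + b * a + 0ℚ ; D = d * (b * b) ; s = a * a + D in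
      v₀ * w₁ + v₁ * w₀ ≡ [ 2 ]ℚ * (b * ([ 2 ]ℚ * ([ 5 ]ℚ * (a * s)) + [ 14 ]ℚ * a))
    lem = solve-∀ ℚ-ring

  z²-re : ∀ a b → let x = a + b √ ; D = d * (b * b) ; s = a * a + D in
    re {d} (⊝ ((ι [ 3 ]ℚ ⊗ x ⊗ x ⊕ ι 1ℚ) ⊗ (x ⊗ x ⊖ ι [ 5 ]ℚ))) ≡ - [ 3 ]ℚ * (s * s + [ 4 ]ℚ *
        (a * a * D)) + [ 14 ]ℚ * s + [ 5 ]ℚ
  z²-re a b = lem d a b
    where
    lem : ∀ d a b → let u₀ = [ 3 ]ℚ * a + d * (0ℚ * b) ; u₁ = [ 3 ]ℚ * b + 0ℚ * a
                        v₀ = u₀ * a + d * (u₁ * b) + 1ℚ ; v₁ = u₀ * b + u₁ * a + 0ℚ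
                        w₀ = a * a + d * (b * b) + - [ 5 ]ℚ ; w₁ = a * b + b * a + - 0ℚ ; D = d * (b * b) ; s = a * a + D in
      - (v₀ * w₀ + d * (v₁ * w₁)) ≡ - [ 3 ]ℚ * (s * s + [ 4 ]ℚ * (a * a * D)) + [ 14 ]ℚ * s + [ 5 ]ℚ
    lem = solve-∀ ℚ-ring

  z²-im : ∀ a b → let x = a + b √ ; D = d * (b * b) ; s = a * a + D in
    im {d} (⊝ ((ι [ 3 ]ℚ ⊗ x ⊗ x ⊕ ι 1ℚ) ⊗ (x ⊗ x ⊖ ι [ 5 ]ℚ))) ≡ [ 2 ]ℚ * (b * ([ 2 ]ℚ * (- [ 3 ]ℚ *
        (a * s)) + [ 14 ]ℚ * a))
  z²-im a b = lem d a b
    where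
    lem : ∀ d a b → let u₀ = [ 3 ]ℚ * a + d * (0ℚ * b) ; u₁ = [ 3 ]ℚ * b + 0ℚ * a
                        v₀ = u₀ * a + d * (u₁ * b) + 1ℚ ; v₁ = u₀ * b + u₁ * a + 0ℚ
                        w₀ = a * a + d * (b * b) + - [ 5 ]ℚ ; w₁ = a * b + b * a + - 0ℚ ; D = d * (b * b) ; s = a * a + D in
      - (v₀ * w₁ + v₁ * w₀) ≡ [ 2 ]ℚ * (b * ([ 2 ]ℚ * (- [ 3 ]ℚ * (a * s)) + [ 14 ]ℚ * a))
    lem = solve-∀ ℚ-ring

  halve : ∀ u v R → u * v + v * u ≡ [ 2 ]ℚ * R → u * v ≡ R
  halve u v R eq = by (kill eq ½) (lem u v R)
    where
    lem : ∀ u v R → u * v ≡ R + ½ * (u * v + v * u - [ 2 ]ℚ * R)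
    lem = solve-∀ ℚ-ring

  OnY⇒Lies-on : ∀ {a b y₀ y₁ z₀ z₁} → OnY d (a + b √) (y₀ + y₁ √) (z₀ + z₁ √) →
    Lies-on [ 5 ]ℚ (- [ 3 ]ℚ) d a b y₀ y₁ × Lies-on (- [ 3 ]ℚ) [ 5 ]ℚ d a b z₀ z₁
  OnY⇒Lies-on {a} {b} {y₀} {y₁} {z₀} {z₁} (y-eq , z-eq) =
      (trans (cong re y-eq) (y²-re a b) , halve y₀ y₁ (b * R [ 5 ]ℚ) (trans (cong im y-eq) (y²-im a b)))
    , (trans (cong re z-eq) (z²-re a b) , halve z₀ z₁ (b * R (- [ 3 ]ℚ)) (trans (cong im z-eq) (z²-im a b)))
    where
    R : ℚ → ℚ
    R A = [ 2 ]ℚ * (A * (a * (a * a + d * (b * b)))) + [ 14 ]ℚ * a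

  √-cong : ∀ {x y : Q√ d} → re x ≡ re y → im x ≡ im y → x ≡ y
  √-cong = cong₂ _+_√

  rational-square : ∀ {u v : ℚ} → v ≡ 0ℚ → IsPM u 4 → (u + v √) ⊗ (u + v √) ≡ ι {d} [ 16 ]ℚ
  rational-square {u} {v} v≡0 u≡±4 = √-cong
    (by (kill (IsPM⇒square u 4 u≡±4) 1ℚ ⊞ kill v≡0 (d * v)) (lem₁ d u v)) (by (kill v≡0 ([ 2 ]ℚ * u))
        (lem₂ u v))
    where
    lem₁ : ∀ d u v → u * u + d * (v * v) ≡ [ 16 ]ℚ + (1ℚ * (u * u - [ 4 ]ℚ * [ 4 ]ℚ) + d * v * (v - 0ℚ))
    lem₁ = solve-∀ ℚ-ring
    lem₂ : ∀ u v → u * v + v * u ≡ 0ℚ + [ 2 ]ℚ * u * (v - 0ℚ)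
    lem₂ = solve-∀ ℚ-ring

  listed⇒OnY : ∀ {x y z} → IsListedPoint d x y z → OnY d x y z
  listed⇒OnY {a + b √} {y₀ + y₁ √} {z₀ + z₁ √} (b≡0 , y₁≡0 , z₁≡0 , a≡±1 , y₀≡±4 , z₀≡±4) =
      trans (rational-square y₁≡0 y₀≡±4) (sym (√-cong (trans (y²-re a b) (real [ 5 ]ℚ)) (trans
          (y²-im a b) (imaginary [ 5 ]ℚ))))
    , trans (rational-square z₁≡0 z₀≡±4) (sym (√-cong (trans (z²-re a b) (real (- [ 3 ]ℚ))) (trans
        (z²-im a b) (imaginary (- [ 3 ]ℚ)))))
    where
    s = a * a + d * (b * b)
    real : ∀ A → A * (s * s + [ 4 ]ℚ * (a * a * (d * (b * b)))) + [ 14 ]ℚ * s + ([ 2 ]ℚ - A) ≡ [ 16 ]ℚ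
    real A = by (kill (IsPM⇒square a 1 a≡±1) (A * (a * a + 1ℚ) + [ 14 ]ℚ)
        ⊞ kill b≡0 (A * ([ 6 ]ℚ * (a * a) + d * (b * b)) * (d * b) + [ 14 ]ℚ * (d * b))) (lem A d a b)
      where
      lem : ∀ A d a b → let D = d * (b * b) ; s = a * a + D in
        A * (s * s + [ 4 ]ℚ * (a * a * D)) + [ 14 ]ℚ * s + ([ 2 ]ℚ - A) ≡ [ 16 ]ℚ
        + ((A * (a * a + 1ℚ) + [ 14 ]ℚ) * (a * a - 1ℚ * 1ℚ) + (A * ([ 6 ]ℚ * (a * a) + d * (b * b)) *
            (d * b) + [ 14 ]ℚ * (d * b)) * (b - 0ℚ))
      lem = solve-∀ ℚ-ring
    imaginary : ∀ A → [ 2 ]ℚ * (b * ([ 2 ]ℚ * (A * (a * s)) + [ 14 ]ℚ * a)) ≡ 0ℚ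
    imaginary A = by (kill b≡0 ([ 2 ]ℚ * R)) (lem b R)
      where
      R = [ 2 ]ℚ * (A * (a * s)) + [ 14 ]ℚ * a
      lem : ∀ b R → [ 2 ]ℚ * (b * R) ≡ 0ℚ + [ 2 ]ℚ * R * (b - 0ℚ)
      lem = solve-∀ ℚ-ring

theorem5p15 : (d : ℚ) → NonSquare d → (x y z : Q√ d) →
    OnY d x y z ⇔ IsListedPoint d x y z
theorem5p15 d d-nonsquare (a + b √) (y₀ + y₁ √) (z₀ + z₁ √) = mk⇔ (λ onY → forward
    (OnY⇒Lies-on {d} {a} {b} {y₀} {y₁} {z₀} {z₁} onY) (b ≟ 0ℚ)) listed⇒OnY
  where
  forward : Lies-on [ 5 ]ℚ (- [ 3 ]ℚ) d a b y₀ y₁ × Lies-on (- [ 3 ]ℚ) [ 5 ]ℚ d a b z₀ z₁ → Dec (b ≡ 0ℚ) →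
    IsListedPoint d (a + b √) (y₀ + y₁ √) (z₀ + z₁ √)
  forward (y-lies , z-lies) (yes b≡0) = listed {d} {a} {b} {y₀} {y₁} {z₀} {z₁} d-nonsquare y-lies z-lies b≡0
  forward (y-lies , z-lies) (no b≢0) = ⊥-elim
      (irrational-abscissa⇒⊥ {d} {a} {b} {y₀} {y₁} {z₀} {z₁} d-nonsquare y-lies z-lies b≢0)
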